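{- There is a static data structure (called vcode) which, for every ordered set $S\subset\{0,1,\ldots,n-1\}$ with $m$ elements, stores a representation of $S$ in $m\log_2\!\left(\frac{n}{(\log_2 n)^2}\right)+o(n)$ bits in the worst case, and which, on the word RAM, answers each query $\mathrm{rank}(x,S)$ in $O(\log^2 n)$ worst-case time and each query $\mathrm{select}(i,S)$ in $O(\log n)$ worst-case time.
   Context: For $S\subset\{0,1,\ldots,n-1\}$: $\mathrm{rank}(x,S)$ is the number of elements of $S$ which are no greater than $x$, and $\mathrm{select}(i,S)$ is the $i$-th smallest element of $S$. Word RAM model: logical and arithmetic operations on two $O(\log n)$-bit integers take constant time, and any consecutive $O(\log n)$ bits of memory at any address can be read or written in constant time. Here $\log^2 n=(\log n)^2$, and the term $o(n)$ is as $n\to\infty$. -}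

module Defs where

open import Algebra.Bundles using (CommutativeRing)
open import Data.Bool.Base using (Bool; true; false; if_then_else_; _∧_; _∨_; _xor_)
open import Data.Empty using (⊥; ⊥-elim)
open import Data.Fin.Base using (Fin; zero; suc; toℕ)
import Data.Fin.Properties as FinP
open import Data.Fin.Subset using (Subset; inside; outside; _∩_; ∣_∣)
open import Data.Integer.Base as ℤ using (ℤ; +_; _⊖_)
import Data.Integer.Properties as ℤP
open import Data.List.Base as List using (List; length; drop; head)
open import Data.Maybe.Base using (maybe′)
open import Data.Nat.Base as ℕ using (ℕ; zero; suc)
open import Data.Nat.DivMod using (_/_; _%_)
open import Data.Nat.Logarithm using (⌊log₂_⌋)
import Data.Nat.Properties as ℕP
open import Data.Product.Base using (∃; ∃₂; _×_; _,_)
open import Data.Rational.Base as ℚ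
  using (ℚ; mkℚ; 0ℚ; 1ℚ; ½)
open import Data.Rational.Literals using (fromℤ)
open import Data.Rational.Properties as ℚP using (+-*-commutativeRing)
open import Data.Rational.Unnormalised.Base as ℚᵘ using (mkℚᵘ; *≤*)
import Data.Rational.Unnormalised.Properties as ℚᵘP
open import Data.Rational.Solver using (module +-*-Solver)
open import Data.Sum.Base using (_⊎_; inj₁; inj₂; [_,_]′)
open import Data.Vec.Base using ([]; _∷_; tabulate)
open import Relation.Binary.PropositionalEquality
  using (_≡_; refl; sym; trans; cong; cong₂; subst; subst₂)
open import Relation.Nullary.Decidable using (yes; no; does; from-yes)
import Algebra.Solver.Ring.NaturalCoefficients.Default
  (CommutativeRing.commutativeSemiring +-*-commutativeRing) as ℕ-Solver
import Algebra.Properties.CommutativeSemiring.Exp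
  (CommutativeRing.commutativeSemiring +-*-commutativeRing) as Exp
open Exp using (_^_)

fromℕℚ : ℕ → ℚ
fromℕℚ n = fromℤ (+ n)

------------------------------------------------------------------------
-- Rational arithmetic

abstract

  ≤-or-> : ∀ p q → p ℚ.≤ q ⊎ q ℚ.< p
  ≤-or-> p q with p ℚP.≤? q
  ... | yes p≤q = inj₁ p≤q
  ... | no  p≰q = inj₂ (ℚP.≰⇒> p≰q)

  pos+ : ∀ {p q} → 0ℚ ℚ.< p → 0ℚ ℚ.< q → 0ℚ ℚ.< p ℚ.+ q
  pos+ 0<p 0<q = ℚP.+-mono-< 0<p 0<q

  pos* : ∀ {p q} → 0ℚ ℚ.< p → 0ℚ ℚ.< q → 0ℚ ℚ.< p ℚ.* q
  pos* {p} {q} 0<p 0<q = ℚP.positive⁻¹ _ {{ℚP.pos*pos⇒pos p {{ℚ.positive 0<p}} q {{ℚ.positive 0<q}}}}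

  *-mono-≤ : ∀ {p q r s} → 0ℚ ℚ.≤ p → 0ℚ ℚ.≤ s → p ℚ.≤ q → r ℚ.≤ s → p ℚ.* r ℚ.≤ q ℚ.* s
  *-mono-≤ {p} {s = s} 0≤p 0≤s p≤q r≤s = ℚP.≤-trans
    (ℚP.*-monoˡ-≤-nonNeg p {{ℚ.nonNegative 0≤p}} r≤s)
    (ℚP.*-monoʳ-≤-nonNeg s {{ℚ.nonNegative 0≤s}} p≤q)

  *-monoˡ-< : ∀ {p q} r → 0ℚ ℚ.< r → p ℚ.< q → r ℚ.* p ℚ.< r ℚ.* q
  *-monoˡ-< r 0<r = ℚP.*-monoʳ-<-pos r {{ℚ.positive 0<r}}

  recip : ∀ {p} → 0ℚ ℚ.< p → ∃ λ r → 0ℚ ℚ.< r × r ℚ.* p ≡ 1ℚ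
  recip {p} 0<p =
    ℚ.1/_ p {{nz}} , ℚP.positive⁻¹ _ {{ℚP.1/pos⇒pos p {{ℚ.positive 0<p}}}} , ℚP.*-inverseˡ p {{nz}}
    where
    nz : ℚ.NonZero p
    nz = ℚ.>-nonZero 0<p

  recip-pos : ∀ {p} r → 0ℚ ℚ.< p → r ℚ.* p ≡ 1ℚ → 0ℚ ℚ.< r
  recip-pos {p} r 0<p rp≡1 = ℚP.*-cancelʳ-<-nonNeg p {{ℚ.nonNegative (ℚP.<⇒≤ 0<p)}}
    (subst₂ ℚ._<_ (sym (ℚP.*-zeroˡ p)) (sym rp≡1) (from-yes (0ℚ ℚP.<? 1ℚ)))

  p<p+1 : ∀ p → p ℚ.< p ℚ.+ 1ℚ
  p<p+1 p = subst (ℚ._< p ℚ.+ 1ℚ) (ℚP.+-identityʳ p) (ℚP.+-monoʳ-< p (from-yes (0ℚ ℚP.<? 1ℚ)))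

  p-1<p : ∀ p → p ℚ.- 1ℚ ℚ.< p
  p-1<p p = subst (p ℚ.- 1ℚ ℚ.<_) (ℚP.+-identityʳ p) (ℚP.+-monoʳ-< p (from-yes (ℚ.- 1ℚ ℚP.<? 0ℚ)))

  p≤p+q : ∀ p {q} → 0ℚ ℚ.≤ q → p ℚ.≤ p ℚ.+ q
  p≤p+q p 0≤q = ℚP.≤-trans (ℚP.≤-reflexive (sym (ℚP.+-identityʳ p))) (ℚP.+-monoʳ-≤ p 0≤q)

  p<p+q : ∀ p {q} → 0ℚ ℚ.< q → p ℚ.< p ℚ.+ q
  p<p+q p 0<q = ℚP.≤-<-trans (ℚP.≤-reflexive (sym (ℚP.+-identityʳ p))) (ℚP.+-monoʳ-< p 0<q)

  p+[q-p]≡q : ∀ p q → p ℚ.+ (q ℚ.- p) ≡ q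
  p+[q-p]≡q p q = trans (cong (p ℚ.+_) (ℚP.+-comm q (ℚ.- p)))
    (trans (sym (ℚP.+-assoc p (ℚ.- p) q)) (trans (cong (ℚ._+ q) (ℚP.+-inverseʳ p)) (ℚP.+-identityˡ q)))

  diff-pos : ∀ {p q} → p ℚ.< q → 0ℚ ℚ.< q ℚ.- p
  diff-pos {p} {q} p<q = subst (ℚ._< q ℚ.- p) (ℚP.+-inverseʳ p) (ℚP.+-monoˡ-< (ℚ.- p) p<q)

  /-mono-≤ : ∀ i j k l → i ℤ.* + suc l ℤ.≤ j ℤ.* + suc k → i ℚ./ suc k ℚ.≤ j ℚ./ suc l
  /-mono-≤ i j k l h = ℚP.toℚᵘ-cancel-≤ (begin
    ℚ.toℚᵘ (i ℚ./ suc k)  ≃⟨ ℚP.toℚᵘ-fromℚᵘ (mkℚᵘ i k) ⟩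
    mkℚᵘ i k              ≤⟨ *≤* h ⟩
    mkℚᵘ j l              ≃⟨ ℚP.toℚᵘ-fromℚᵘ (mkℚᵘ j l) ⟨
    ℚ.toℚᵘ (j ℚ./ suc l)  ∎)
    where open ℚᵘP.≤-Reasoning

  /-+ : ∀ i j k → (i ℤ.+ j) ℚ./ suc k ≡ i ℚ./ suc k ℚ.+ j ℚ./ suc k
  /-+ i j k = ℚP.toℚᵘ-injective (begin
    ℚ.toℚᵘ ((i ℤ.+ j) ℚ./ suc k)  ≈⟨ ℚP.toℚᵘ-fromℚᵘ (mkℚᵘ (i ℤ.+ j) k) ⟩
    mkℚᵘ (i ℤ.+ j) k              ≈⟨ ℚᵘ.*≡* eq ⟩
    mkℚᵘ i k ℚᵘ.+ mkℚᵘ j k        ≈⟨ ℚᵘP.+-cong (ℚP.toℚᵘ-fromℚᵘ (mkℚᵘ i k)) (ℚP.toℚᵘ-fromℚᵘ (mkℚᵘ j k)) ⟨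
    ℚ.toℚᵘ (i ℚ./ suc k) ℚᵘ.+ ℚ.toℚᵘ (j ℚ./ suc k)  ≈⟨ ℚP.toℚᵘ-homo-+ (i ℚ./ suc k) (j ℚ./ suc k) ⟨
    ℚ.toℚᵘ (i ℚ./ suc k ℚ.+ j ℚ./ suc k)  ∎)
    where
    open import Relation.Binary.Reasoning.Setoid ℚᵘP.≃-setoid
    K : ℤ
    K = + suc k
    eq : (i ℤ.+ j) ℤ.* + (suc k ℕ.* suc k) ≡ (i ℤ.* K ℤ.+ j ℤ.* K) ℤ.* K
    eq = trans (cong ((i ℤ.+ j) ℤ.*_) (ℤP.pos-* (suc k) (suc k)))
        (trans (sym (ℤP.*-assoc (i ℤ.+ j) K K)) (cong (ℤ._* K) (ℤP.*-distribʳ-+ K i j)))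

  n/1≡n : ∀ n → + n ℚ./ 1 ≡ fromℕℚ n
  n/1≡n n = ℚP.↥p/↧p≡p (fromℕℚ n)

  0<suc : ∀ n → 0ℚ ℚ.< fromℕℚ (suc n)
  0<suc n = ℚP.positive⁻¹ (fromℕℚ (suc n))

  fromℕℚ-suc : ∀ n → fromℕℚ (suc n) ≡ 1ℚ ℚ.+ fromℕℚ n
  fromℕℚ-suc n = trans (sym (n/1≡n (suc n))) (trans (/-+ (+ 1) (+ n) 0) (cong (1ℚ ℚ.+_) (n/1≡n n)))

  fromℕℚ-mono : ∀ {m n} → m ℕ.≤ n → fromℕℚ m ℚ.≤ fromℕℚ n
  fromℕℚ-mono {m} {n} m≤n = ℚ.*≤* (ℤP.*-monoʳ-≤-nonNeg (+ 1) (ℤ.+≤+ m≤n))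

  archimedean : ∀ p → ∃ λ n → p ℚ.≤ fromℕℚ n
  archimedean p@(mkℚ i d _) = ℤ.∣ i ∣ , ℚ.*≤* (ℤP.≤-trans (ℤP.≤-reflexive (ℤP.*-identityʳ i))
      (ℤP.≤-trans (lemma i) (ℤP.≤-trans (ℤP.≤-reflexive (sym (ℤP.*-identityʳ _)))
        (ℤP.*-monoˡ-≤-nonNeg (+ ℤ.∣ i ∣) (ℤ.+≤+ (ℕ.s≤s ℕ.z≤n))))))
    where
    lemma : ∀ i → i ℤ.≤ + ℤ.∣ i ∣
    lemma (+ n) = ℤP.≤-refl
    lemma ℤ.-[1+ n ] = ℤ.-≤+

  2/n*n : ∀ n → + 2 ℚ./ suc n ℚ.* fromℕℚ (suc n) ≡ 1ℚ ℚ.+ 1ℚ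
  2/n*n n = ℚP.toℚᵘ-injective (ℚᵘP.≃-trans (ℚP.toℚᵘ-homo-* (+ 2 ℚ./ suc n) (fromℕℚ (suc n)))
    (ℚᵘP.≃-trans (ℚᵘP.*-cong (ℚP.toℚᵘ-fromℚᵘ (mkℚᵘ (+ 2) n)) (ℚᵘP.≃-refl {mkℚᵘ (+ suc n) 0}))
      (ℚᵘ.*≡* (trans (ℤP.*-identityʳ _) (cong (+ 2 ℤ.*_) (cong +_ (sym (ℕP.*-identityʳ (suc n)))))))))

  2/N<ε : ∀ {ε r t N} → 0ℚ ℚ.< ε → r ℚ.* ε ≡ 1ℚ → r ℚ.+ r ℚ.< N → t ℚ.* N ≡ 1ℚ ℚ.+ 1ℚ → 0ℚ ℚ.< N → t ℚ.< ε
  2/N<ε {ε} {r} {t} {N} 0<ε rε≡1 h tN 0<N =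
    ℚP.*-cancelʳ-<-nonNeg N {{ℚ.nonNegative (ℚP.<⇒≤ 0<N)}} (begin-strict
      t ℚ.* N                   ≡⟨ tN ⟩
      1ℚ ℚ.+ 1ℚ                 ≡⟨ cong₂ ℚ._+_ (sym rε≡1) (sym rε≡1) ⟩
      r ℚ.* ε ℚ.+ r ℚ.* ε       ≡⟨ ℚP.*-distribʳ-+ ε r r ⟨
      (r ℚ.+ r) ℚ.* ε           ≡⟨ ℚP.*-comm (r ℚ.+ r) ε ⟩
      ε ℚ.* (r ℚ.+ r)           <⟨ *-monoˡ-< ε 0<ε h ⟩
      ε ℚ.* N                   ∎)
    where open ℚP.≤-Reasoning

  n<suc : ∀ n → fromℕℚ n ℚ.< fromℕℚ (suc n)
  n<suc n = ℚP.<-≤-trans (p<p+1 (fromℕℚ n))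
    (ℚP.≤-reflexive (trans (ℚP.+-comm (fromℕℚ n) 1ℚ) (sym (fromℕℚ-suc n))))

  -- Every positive rational exceeds 2 / suc k for some k.
  small : ∀ {ε} → 0ℚ ℚ.< ε → ∃ λ k → + 2 ℚ./ suc k ℚ.< ε
  small {ε} 0<ε =
    let (r , _ , rε≡1) = recip 0<ε
        (n , h) = archimedean (r ℚ.+ r)
    in n , 2/N<ε {r = r} 0<ε rε≡1 (ℚP.≤-<-trans h (n<suc n)) (2/n*n n) (0<suc n)

  third : ∀ {ε} → 0ℚ ℚ.< ε → ∃ λ δ → 0ℚ ℚ.< δ × δ ℚ.+ δ ℚ.< ε
  third {ε} 0<ε = ε ℚ.* t , pos* 0<ε (from-yes (0ℚ ℚP.<? t)) , ℚP.≤-<-trans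
    (ℚP.≤-reflexive (sym (ℚP.*-distribˡ-+ ε t t)))
    (ℚP.<-≤-trans (*-monoˡ-< ε 0<ε (from-yes (t ℚ.+ t ℚP.<? 1ℚ))) (ℚP.≤-reflexive (ℚP.*-identityʳ ε)))
    where
    t : ℚ
    t = + 1 ℚ./ 3

  reach : ∀ u p {δ} → 0ℚ ℚ.< δ → ∃ λ n → u ℚ.≤ p ℚ.+ fromℕℚ n ℚ.* δ
  reach u p {δ} 0<δ with recip 0<δ
  ... | r , 0<r , rδ≡1 with archimedean ((u ℚ.- p) ℚ.* r)
  ... | n , h = n , (begin
      u                                 ≡⟨ p+[q-p]≡q p u ⟨
      p ℚ.+ (u ℚ.- p)                   ≡⟨ cong (p ℚ.+_) (ℚP.*-identityʳ (u ℚ.- p)) ⟨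
      p ℚ.+ (u ℚ.- p) ℚ.* 1ℚ            ≡⟨ cong (λ t → p ℚ.+ (u ℚ.- p) ℚ.* t) rδ≡1 ⟨
      p ℚ.+ (u ℚ.- p) ℚ.* (r ℚ.* δ)     ≡⟨ cong (p ℚ.+_) (ℚP.*-assoc (u ℚ.- p) r δ) ⟨
      p ℚ.+ (u ℚ.- p) ℚ.* r ℚ.* δ       ≤⟨ ℚP.+-monoʳ-≤ p (ℚP.*-monoʳ-≤-nonNeg δ {{ℚ.nonNegative (ℚP.<⇒≤ 0<δ)}} h) ⟩
      p ℚ.+ fromℕℚ n ℚ.* δ              ∎)
    where open ℚP.≤-Reasoning

  walk-zero : ∀ p δ → p ℚ.+ fromℕℚ 0 ℚ.* δ ℚ.≤ p
  walk-zero p δ = ℚP.≤-reflexive (trans (cong (p ℚ.+_) (ℚP.*-zeroˡ δ)) (ℚP.+-identityʳ p))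

  walk-suc : ∀ p n δ → p ℚ.+ fromℕℚ (suc n) ℚ.* δ ℚ.≤ p ℚ.+ δ ℚ.+ fromℕℚ n ℚ.* δ
  walk-suc p n δ = ℚP.≤-reflexive (trans (cong (λ t → p ℚ.+ t ℚ.* δ) (fromℕℚ-suc n))
    (solve 3 (λ a m d → a :+ (con 1 :+ m) :* d := a :+ d :+ m :* d) refl p (fromℕℚ n) δ))
    where open ℕ-Solver

------------------------------------------------------------------------
-- Real numbers

-- Dedekind cuts: lower x p says p < x, and upper x q says x < q.
record ℝ : Set₁ where
  field
    lower upper     : ℚ → Set
    lower-inhabited : ∃ lower
    upper-inhabited : ∃ upper
    lower-closed    : ∀ {p q} → p ℚ.< q → lower q → lower p
    upper-closed    : ∀ {p q} → p ℚ.< q → upper p → upper q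
    lower-open      : ∀ {p} → lower p → ∃ λ q → p ℚ.< q × lower q
    upper-open      : ∀ {q} → upper q → ∃ λ p → p ℚ.< q × upper p
    disjoint        : ∀ {p} → lower p → upper p → ⊥
    located         : ∀ {p q} → p ℚ.< q → lower p ⊎ upper q

open ℝ public

infix 4 _≤_

_≤_ : ℝ → ℝ → Set
x ≤ y = ∀ {p} → lower x p → lower y p

abstract

  lower<upper : ∀ x {p q} → lower x p → upper x q → p ℚ.< q
  lower<upper x {p} {q} p<x x<q with ≤-or-> q p
  ... | inj₂ p<q = p<q
  ... | inj₁ q≤p = let (r , p<r , r<x) = lower-open x p<x in
    ⊥-elim (disjoint x (lower-closed x (ℚP.≤-<-trans q≤p p<r) r<x) x<q)

  -- Walk up from p in steps of δ until located reports an upper bound;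
  -- n steps would pass the upper bound u.
  walk : ∀ x {u δ ε} → upper x u → 0ℚ ℚ.< δ → δ ℚ.+ δ ℚ.< ε →
         ∀ n p → lower x p → u ℚ.≤ p ℚ.+ fromℕℚ n ℚ.* δ →
         ∃₂ λ p q → lower x p × upper x q × q ℚ.< p ℚ.+ ε
  walk x {u} {δ} x<u 0<δ 2δ<ε zero p p<x h =
    ⊥-elim (ℚP.<-irrefl refl (ℚP.<-≤-trans (lower<upper x p<x x<u) (ℚP.≤-trans h (walk-zero p δ))))
  walk x {u} {δ} x<u 0<δ 2δ<ε (suc n) p p<x h with located x (ℚP.+-monoʳ-< p (p<p+q δ 0<δ))
  ... | inj₂ x<p+2δ = p , p ℚ.+ (δ ℚ.+ δ) , p<x , x<p+2δ , ℚP.+-monoʳ-< p 2δ<ε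
  ... | inj₁ p+δ<x  = walk x x<u 0<δ 2δ<ε n (p ℚ.+ δ) p+δ<x (ℚP.≤-trans h (walk-suc p n δ))

  approx : ∀ x {ε} → 0ℚ ℚ.< ε → ∃₂ λ p q → lower x p × upper x q × q ℚ.< p ℚ.+ ε
  approx x 0<ε =
    let (p , p<x) = lower-inhabited x
        (u , x<u) = upper-inhabited x
        (δ , 0<δ , 2δ<ε) = third 0<ε
        (n , h) = reach u p 0<δ
    in walk x x<u 0<δ 2δ<ε n p p<x h

  approx≥ : ∀ x {l ε} → lower x l → 0ℚ ℚ.< ε →
            ∃₂ λ p q → l ℚ.≤ p × lower x p × upper x q × q ℚ.< p ℚ.+ ε
  approx≥ x {l} {ε} l<x 0<ε =
    let (p , q , p<x , x<q , h) = approx x 0<ε in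
    [ (λ l≤p → p , q , l≤p , p<x , x<q , h)
    , (λ p<l → l , q , ℚP.≤-refl , l<x , x<q , ℚP.<-trans h (ℚP.+-monoˡ-< ε p<l)) ]′ (≤-or-> l p)

  squeeze-located : ∀ {A B : ℚ → Set} →
    (∀ {ε} → 0ℚ ℚ.< ε → ∃₂ λ a b → A a × B b × b ℚ.< a ℚ.+ ε) →
    ∀ {p q} → p ℚ.< q → (∃ λ a → A a × p ℚ.< a) ⊎ (∃ λ b → B b × b ℚ.< q)
  squeeze-located {A} {B} close {p} {q} p<q =
    let (a , b , Aa , Bb , h) = close (diff-pos p<q) in
    [ (λ a≤p → inj₂ (b , Bb , ℚP.<-≤-trans h
        (ℚP.≤-trans (ℚP.+-monoˡ-≤ (q ℚ.- p) a≤p) (ℚP.≤-reflexive (p+[q-p]≡q p q)))))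
    , (λ p<a → inj₁ (a , Aa , p<a)) ]′ (≤-or-> a p)

-- The real number squeezed between the rationals in A and those in B.
squeeze : (A B : ℚ → Set) →
          (∀ {a b} → A a → B b → a ℚ.≤ b) →
          (∀ {ε} → 0ℚ ℚ.< ε → ∃₂ λ a b → A a × B b × b ℚ.< a ℚ.+ ε) → ℝ
squeeze A B A≤B close = record
  { lower           = λ p → ∃ λ a → A a × p ℚ.< a
  ; upper           = λ q → ∃ λ b → B b × b ℚ.< q
  ; lower-inhabited = let (a , _ , Aa , _) = close₁ in _ , a , Aa , p-1<p a
  ; upper-inhabited = let (_ , b , _ , Bb , _) = close₁ in _ , b , Bb , p<p+1 b
  ; lower-closed    = λ { p<q (a , Aa , q<a) → a , Aa , ℚP.<-trans p<q q<a }
  ; upper-closed    = λ { p<q (b , Bb , b<p) → b , Bb , ℚP.<-trans b<p p<q }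
  ; lower-open      = λ { (a , Aa , p<a) →
                          let (m , p<m , m<a) = ℚP.<-dense p<a in m , p<m , a , Aa , m<a }
  ; upper-open      = λ { (b , Bb , b<q) →
                          let (m , b<m , m<q) = ℚP.<-dense b<q in m , m<q , b , Bb , b<m }
  ; disjoint        = λ { (a , Aa , p<a) (b , Bb , b<p) →
                          ℚP.<-irrefl refl (ℚP.<-≤-trans (ℚP.<-trans b<p p<a) (A≤B Aa Bb)) }
  ; located         = squeeze-located close
  }
  where
  close₁ = close (from-yes (0ℚ ℚP.<? 1ℚ))

fromℚ : ℚ → ℝ
fromℚ r = squeeze (_≡ r) (_≡ r) (λ { refl refl → ℚP.≤-refl }) λ 0<ε → r , r , refl , refl , p<p+q r 0<ε

fromℕ : ℕ → ℝ
fromℕ n = fromℚ (fromℕℚ n)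

infixl 6 _+_

_+_ : ℝ → ℝ → ℝ
x + y = squeeze
  (λ r → ∃₂ λ p q → lower x p × lower y q × r ≡ p ℚ.+ q)
  (λ r → ∃₂ λ p q → upper x p × upper y q × r ≡ p ℚ.+ q)
  (λ { (p , q , p<x , q<y , refl) (p′ , q′ , x<p′ , y<q′ , refl) →
       ℚP.<⇒≤ (ℚP.+-mono-< (lower<upper x p<x x<p′) (lower<upper y q<y y<q′)) })
  close
  where
  close : ∀ {ε} → 0ℚ ℚ.< ε → _
  close {ε} 0<ε =
    let 0<ε/2 = subst (ℚ._< ε ℚ.* ½) (ℚP.*-zeroˡ ½) (ℚP.*-monoˡ-<-pos ½ 0<ε)
        (p , p′ , p<x , x<p′ , h) = approx x 0<ε/2
        (q , q′ , q<y , y<q′ , k) = approx y 0<ε/2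
    in p ℚ.+ q , p′ ℚ.+ q′ , (p , q , p<x , q<y , refl) , (p′ , q′ , x<p′ , y<q′ , refl)
     , ℚP.<-≤-trans (ℚP.+-mono-< h k) (ℚP.≤-reflexive
         (trans (solve 3 (λ a b e → a :+ e :+ (b :+ e) := a :+ b :+ (e :+ e)) refl p q (ε ℚ.* ½))
           (cong (p ℚ.+ q ℚ.+_) (trans (sym (ℚP.*-distribˡ-+ ε ½ ½)) (ℚP.*-identityʳ ε)))))
    where open ℕ-Solver

infixr 7 _·_

_·_ : ℕ → ℝ → ℝ
zero  · x = fromℚ 0ℚ
suc m · x = x + m · x

record ℝ⁺ : Set₁ where
  constructor _,_
  field
    real     : ℝ
    positive : lower real 0ℚ

open ℝ⁺ public

abstract
  lower⁺ : (x : ℝ⁺) → ∃ λ l → 0ℚ ℚ.< l × lower (real x) l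
  lower⁺ x = lower-open (real x) (positive x)

fromℕ⁺ : (n : ℕ) .{{_ : ℕ.NonZero n}} → ℝ⁺
fromℕ⁺ n@(suc _) = fromℕ n , (fromℕℚ n , refl , 0<suc _)

infixl 7 _*_
infix  8 _⁻¹

_*_ : ℝ⁺ → ℝ⁺ → ℝ⁺
x * y = squeeze A B A≤B close , pos
  where
  A B : ℚ → Set
  A r = ∃₂ λ p q → 0ℚ ℚ.< p × lower (real x) p × 0ℚ ℚ.< q × lower (real y) q × r ≡ p ℚ.* q
  B r = ∃₂ λ p q → upper (real x) p × upper (real y) q × r ≡ p ℚ.* q
  A≤B : ∀ {a b} → A a → B b → a ℚ.≤ b
  A≤B (p , q , 0<p , p<x , 0<q , q<y , refl) (p′ , q′ , x<p′ , y<q′ , refl) =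
    let p≤p′ = ℚP.<⇒≤ (lower<upper (real x) p<x x<p′)
        q≤q′ = ℚP.<⇒≤ (lower<upper (real y) q<y y<q′)
    in *-mono-≤ (ℚP.<⇒≤ 0<p) (ℚP.≤-trans (ℚP.<⇒≤ 0<q) q≤q′) p≤p′ q≤q′
  pos : ∃ λ a → A a × 0ℚ ℚ.< a
  pos = let (p , 0<p , p<x) = lower⁺ x
            (q , 0<q , q<y) = lower⁺ y
        in p ℚ.* q , (p , q , 0<p , p<x , 0<q , q<y , refl) , pos* 0<p 0<q
  close : ∀ {ε} → 0ℚ ℚ.< ε → ∃₂ λ a b → A a × B b × b ℚ.< a ℚ.+ ε
  close {ε} 0<ε =
    let (p₀ , 0<p₀ , p₀<x) = lower⁺ x
        (q₀ , 0<q₀ , q₀<y) = lower⁺ y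
        (u , x<u) = upper-inhabited (real x)
        (v , y<v) = upper-inhabited (real y)
        C = u ℚ.+ v ℚ.+ 1ℚ ℚ.+ ε
        0<u = ℚP.<-trans 0<p₀ (lower<upper (real x) p₀<x x<u)
        0<v = ℚP.<-trans 0<q₀ (lower<upper (real y) q₀<y y<v)
        0<uv1 = pos+ (pos+ 0<u 0<v) (from-yes (0ℚ ℚP.<? 1ℚ))
        0<C = pos+ 0<uv1 0<ε
        (c , 0<c , cC≡1) = recip 0<C
        δ = ε ℚ.* c
        0<δ = pos* 0<ε 0<c
        δ≤1 = ℚP.≤-trans (ℚP.≤-reflexive (ℚP.*-comm ε c)) (ℚP.≤-trans
                (ℚP.*-monoˡ-≤-nonNeg c {{ℚ.nonNegative (ℚP.<⇒≤ 0<c)}} {ε} {C}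
                  (ℚP.≤-trans (p≤p+q ε (ℚP.<⇒≤ 0<uv1)) (ℚP.≤-reflexive (ℚP.+-comm ε _))))
                (ℚP.≤-reflexive cC≡1))
        (p , p′ , p₀≤p , p<x , x<p′ , h) = approx≥ (real x) p₀<x 0<δ
        (q , q′ , q₀≤q , q<y , y<q′ , k) = approx≥ (real y) q₀<y 0<δ
        0<p = ℚP.<-≤-trans 0<p₀ p₀≤p
        0<q = ℚP.<-≤-trans 0<q₀ q₀≤q
        0<p′ = ℚP.<-trans 0<p (lower<upper (real x) p<x x<p′)
    in p ℚ.* q , p′ ℚ.* q′ , (p , q , 0<p , p<x , 0<q , q<y , refl) , (p′ , q′ , x<p′ , y<q′ , refl)
     , (begin-strict
         p′ ℚ.* q′                                ≤⟨ *-mono-≤ (ℚP.<⇒≤ 0<p′) (ℚP.<⇒≤ (pos+ 0<q 0<δ)) (ℚP.<⇒≤ h) (ℚP.<⇒≤ k) ⟩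
         (p ℚ.+ δ) ℚ.* (q ℚ.+ δ)                  ≡⟨ solve 3 (λ a b d → (a :+ d) :* (b :+ d) := a :* b :+ d :* (a :+ b :+ d)) refl p q δ ⟩
         p ℚ.* q ℚ.+ δ ℚ.* (p ℚ.+ q ℚ.+ δ)        <⟨ ℚP.+-monoʳ-< (p ℚ.* q) (*-monoˡ-< δ 0<δ
                                                     (ℚP.<-trans (ℚP.+-mono-<-≤ (ℚP.+-mono-< (lower<upper (real x) p<x x<u) (lower<upper (real y) q<y y<v)) δ≤1)
                                                        (p<p+q _ 0<ε))) ⟩
         p ℚ.* q ℚ.+ δ ℚ.* C                      ≡⟨ cong (p ℚ.* q ℚ.+_) (trans (ℚP.*-assoc ε c C) (trans (cong (ε ℚ.*_) cC≡1) (ℚP.*-identityʳ ε))) ⟩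
         p ℚ.* q ℚ.+ ε                            ∎)
    where
    open ℕ-Solver
    open ℚP.≤-Reasoning

_⁻¹ : ℝ⁺ → ℝ⁺
x ⁻¹ = squeeze A B A≤B close , pos
  where
  A B : ℚ → Set
  A r = ∃ λ q → upper (real x) q × r ℚ.* q ≡ 1ℚ
  B r = ∃ λ p → 0ℚ ℚ.< p × lower (real x) p × r ℚ.* p ≡ 1ℚ
  upper⇒pos : ∀ {q} → upper (real x) q → 0ℚ ℚ.< q
  upper⇒pos = lower<upper (real x) (positive x)
  A≤B : ∀ {a b} → A a → B b → a ℚ.≤ b
  A≤B {a} {b} (q , x<q , aq≡1) (p , 0<p , p<x , bp≡1) = begin
    a                  ≡⟨ trans (cong (a ℚ.*_) bp≡1) (ℚP.*-identityʳ a) ⟨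
    a ℚ.* (b ℚ.* p)    ≤⟨ ℚP.*-monoˡ-≤-nonNeg a {{ℚ.nonNegative (ℚP.<⇒≤ 0<a)}}
                            (ℚP.*-monoˡ-≤-nonNeg b {{ℚ.nonNegative (ℚP.<⇒≤ 0<b)}} (ℚP.<⇒≤ (lower<upper (real x) p<x x<q))) ⟩
    a ℚ.* (b ℚ.* q)    ≡⟨ solve 3 (λ a b q → a :* (b :* q) := b :* (a :* q)) refl a b q ⟩
    b ℚ.* (a ℚ.* q)    ≡⟨ trans (cong (b ℚ.*_) aq≡1) (ℚP.*-identityʳ b) ⟩
    b                  ∎
    where
    open ℕ-Solver
    open ℚP.≤-Reasoning
    0<a = recip-pos a (upper⇒pos x<q) aq≡1
    0<b = recip-pos b 0<p bp≡1
  pos : ∃ λ a → A a × 0ℚ ℚ.< a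
  pos = let (q , x<q) = upper-inhabited (real x)
            (r , 0<r , rq≡1) = recip (upper⇒pos x<q)
        in r , (q , x<q , rq≡1) , 0<r
  close : ∀ {ε} → 0ℚ ℚ.< ε → ∃₂ λ a b → A a × B b × b ℚ.< a ℚ.+ ε
  close {ε} 0<ε =
    let (l , 0<l , l<x) = lower⁺ x
        (p , q , l≤p , p<x , x<q , h) = approx≥ (real x) l<x (pos* 0<ε (pos* 0<l 0<l))
        0<p = ℚP.<-≤-trans 0<l l≤p
        0<q = upper⇒pos x<q
        l≤q = ℚP.≤-trans l≤p (ℚP.<⇒≤ (lower<upper (real x) p<x x<q))
        (a , 0<a , aq≡1) = recip 0<q
        (b , 0<b , bp≡1) = recip 0<p
    in a , b , (q , x<q , aq≡1) , (p , 0<p , p<x , bp≡1)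
     , (begin-strict
         b                                        ≡⟨ trans (cong (b ℚ.*_) aq≡1) (ℚP.*-identityʳ b) ⟨
         b ℚ.* (a ℚ.* q)                          ≡⟨ ℚP.*-assoc b a q ⟨
         b ℚ.* a ℚ.* q                            <⟨ *-monoˡ-< (b ℚ.* a) (pos* 0<b 0<a) (ℚP.<-≤-trans h
                                                       (ℚP.+-monoʳ-≤ p (ℚP.*-monoˡ-≤-nonNeg ε {{ℚ.nonNegative (ℚP.<⇒≤ 0<ε)}}
                                                         (*-mono-≤ (ℚP.<⇒≤ 0<l) (ℚP.<⇒≤ 0<q) l≤p l≤q)))) ⟩
         b ℚ.* a ℚ.* (p ℚ.+ ε ℚ.* (p ℚ.* q))      ≡⟨ solve 5 (λ a b p q e → b :* a :* (p :+ e :* (p :* q)) := a :* (b :* p) :+ e :* (b :* p) :* (a :* q)) refl a b p q ε ⟩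
         a ℚ.* (b ℚ.* p) ℚ.+ ε ℚ.* (b ℚ.* p) ℚ.* (a ℚ.* q)  ≡⟨ cong₂ (λ s t → a ℚ.* s ℚ.+ ε ℚ.* s ℚ.* t) bp≡1 aq≡1 ⟩
         a ℚ.* 1ℚ ℚ.+ ε ℚ.* 1ℚ ℚ.* 1ℚ             ≡⟨ cong₂ ℚ._+_ (ℚP.*-identityʳ a) (trans (ℚP.*-identityʳ _) (ℚP.*-identityʳ ε)) ⟩
         a ℚ.+ ε                                  ∎)
    where
    open ℕ-Solver
    open ℚP.≤-Reasoning

------------------------------------------------------------------------
-- Logarithm

2ℚ : ℚ
2ℚ = fromℕℚ 2

abstract

  0<2^ : ∀ n → 0ℚ ℚ.< 2ℚ ^ n
  0<2^ zero    = from-yes (0ℚ ℚP.<? 1ℚ)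
  0<2^ (suc n) = pos* (from-yes (0ℚ ℚP.<? 2ℚ)) (0<2^ n)

  ^-pos : ∀ {p} n → 0ℚ ℚ.< p → 0ℚ ℚ.< p ^ n
  ^-pos zero    0<p = from-yes (0ℚ ℚP.<? 1ℚ)
  ^-pos (suc n) 0<p = pos* 0<p (^-pos n 0<p)

  ^-mono : ∀ {p q} n → 0ℚ ℚ.< p → p ℚ.≤ q → p ^ n ℚ.≤ q ^ n
  ^-mono zero    0<p p≤q = ℚP.≤-refl
  ^-mono (suc n) 0<p p≤q =
    *-mono-≤ (ℚP.<⇒≤ 0<p) (ℚP.<⇒≤ (^-pos n (ℚP.<-≤-trans 0<p p≤q))) p≤q (^-mono n 0<p p≤q)

  2*p≡p+p : ∀ p → 2ℚ ℚ.* p ≡ p ℚ.+ p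
  2*p≡p+p p = solve 1 (λ p → con 2 :* p := p :+ p) refl p
    where open ℕ-Solver

  1≤2^ : ∀ n → 1ℚ ℚ.≤ 2ℚ ^ n
  1≤2^ zero    = ℚP.≤-refl
  1≤2^ (suc n) = ℚP.≤-trans (1≤2^ n) (ℚP.≤-trans (p≤p+q _ (ℚP.<⇒≤ (0<2^ n)))
                   (ℚP.≤-reflexive (sym (2*p≡p+p (2ℚ ^ n)))))

  n≤2^n : ∀ n → fromℕℚ n ℚ.≤ 2ℚ ^ n
  n≤2^n zero    = from-yes (0ℚ ℚP.≤? 1ℚ)
  n≤2^n (suc n) = begin
    fromℕℚ (suc n)          ≡⟨ fromℕℚ-suc n ⟩
    1ℚ ℚ.+ fromℕℚ n         ≤⟨ ℚP.+-mono-≤ (1≤2^ n) (n≤2^n n) ⟩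
    2ℚ ^ n ℚ.+ 2ℚ ^ n       ≡⟨ 2*p≡p+p (2ℚ ^ n) ⟨
    2ℚ ^ suc n              ∎
    where open ℚP.≤-Reasoning

  2^-cancel-≤ : ∀ m n → 2ℚ ^ m ℚ.≤ 2ℚ ^ n → m ℕ.≤ n
  2^-cancel-≤ m n h with m ℕP.≤? n
  ... | yes m≤n = m≤n
  ... | no  m≰n = ⊥-elim (ℚP.<-irrefl refl (ℚP.<-≤-trans (strict (ℕP.≰⇒> m≰n)) h))
    where
    strict : ∀ {m n} → n ℕ.< m → 2ℚ ^ n ℚ.< 2ℚ ^ m
    strict {suc m} {n} (ℕ.s≤s n≤m) = ℚP.<-≤-trans (p<p+q _ (0<2^ n))
      (ℚP.≤-trans (ℚP.≤-reflexive (sym (2*p≡p+p (2ℚ ^ n))))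
        (ℚP.*-monoˡ-≤-nonNeg 2ℚ (mono n≤m)))
      where
      mono : ∀ {m n} → n ℕ.≤ m → 2ℚ ^ n ℚ.≤ 2ℚ ^ m
      mono {m} ℕ.z≤n = 1≤2^ m
      mono (ℕ.s≤s h) = ℚP.*-monoˡ-≤-nonNeg 2ℚ (mono h)

  -- Binary floor logarithm of a positive rational.
  floorLog : ∀ {t} → 0ℚ ℚ.< t → ∃₂ λ a b → 2ℚ ^ a ℚ.≤ t ℚ.* 2ℚ ^ b × t ℚ.* 2ℚ ^ b ℚ.< 2ℚ ^ suc a
  floorLog {t} 0<t =
    let (r , 0<r , rt≡1) = recip 0<t
        (b , r≤b) = archimedean r
        T = t ℚ.* 2ℚ ^ b
        1≤T = ℚP.≤-trans (ℚP.≤-reflexive (trans (sym rt≡1) (ℚP.*-comm r t)))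
                (ℚP.*-monoˡ-≤-nonNeg t {{ℚ.nonNegative (ℚP.<⇒≤ 0<t)}} (ℚP.≤-trans r≤b (n≤2^n b)))
        (n , T≤n) = archimedean T
        (a , h , k) = search T n 0 1≤T (subst (λ m → T ℚ.< 2ℚ ^ suc m) (sym (ℕP.+-identityʳ n)) (ℚP.≤-<-trans (ℚP.≤-trans T≤n (n≤2^n n))
                        (ℚP.<-≤-trans (p<p+q _ (0<2^ n)) (ℚP.≤-reflexive (sym (2*p≡p+p (2ℚ ^ n)))))))
    in a , b , h , k
    where
    search : ∀ T n a → 2ℚ ^ a ℚ.≤ T → T ℚ.< 2ℚ ^ suc (n ℕ.+ a) →
             ∃ λ a → 2ℚ ^ a ℚ.≤ T × T ℚ.< 2ℚ ^ suc a
    search T zero    a h k = a , h , k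
    search T (suc n) a h k with ≤-or-> (2ℚ ^ suc a) T
    ... | inj₂ T<2^ = a , h , T<2^
    ... | inj₁ 2^≤T = search T n (suc a) 2^≤T (subst (λ m → T ℚ.< 2ℚ ^ suc m) (sym (ℕP.+-suc n a)) k)

  -- (1 + d)ᵏ ≤ 1 + (2ᵏ - 1) d for 0 ≤ d ≤ 1
  bernoulli : ∀ {d} k → 0ℚ ℚ.≤ d → d ℚ.≤ 1ℚ → (1ℚ ℚ.+ d) ^ k ℚ.≤ 1ℚ ℚ.+ (2ℚ ^ k ℚ.- 1ℚ) ℚ.* d
  bernoulli {d} zero 0≤d d≤1 = ℚP.≤-reflexive (solve 1 (λ d → con 1ℚ := con 1ℚ :+ (con 1ℚ :- con 1ℚ) :* d) refl d)
    where open +-*-Solver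
  bernoulli {d} (suc k) 0≤d d≤1 = begin
    (1ℚ ℚ.+ d) ℚ.* (1ℚ ℚ.+ d) ^ k
      ≤⟨ ℚP.*-monoˡ-≤-nonNeg (1ℚ ℚ.+ d) {{ℚ.nonNegative (ℚP.≤-trans (from-yes (0ℚ ℚP.≤? 1ℚ)) (p≤p+q 1ℚ 0≤d))}} (bernoulli k 0≤d d≤1) ⟩
    (1ℚ ℚ.+ d) ℚ.* (1ℚ ℚ.+ E ℚ.* d)
      ≡⟨ ℕ-Solver.solve 2 (λ d E → (ℕ-Solver.con 1 ℕ-Solver.:+ d) ℕ-Solver.:* (ℕ-Solver.con 1 ℕ-Solver.:+ E ℕ-Solver.:* d) ℕ-Solver.:= ℕ-Solver.con 1 ℕ-Solver.:+ (d ℕ-Solver.:+ E ℕ-Solver.:* d) ℕ-Solver.:+ E ℕ-Solver.:* d ℕ-Solver.:* d) refl d E ⟩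
    1ℚ ℚ.+ (d ℚ.+ E ℚ.* d) ℚ.+ E ℚ.* d ℚ.* d
      ≤⟨ ℚP.+-monoʳ-≤ (1ℚ ℚ.+ (d ℚ.+ E ℚ.* d)) (ℚP.*-monoˡ-≤-nonNeg (E ℚ.* d) {{ℚ.nonNegative 0≤Ed}} d≤1) ⟩
    1ℚ ℚ.+ (d ℚ.+ E ℚ.* d) ℚ.+ E ℚ.* d ℚ.* 1ℚ
      ≡⟨ solve 2 (λ d P → con 1ℚ :+ (d :+ (P :- con 1ℚ) :* d) :+ (P :- con 1ℚ) :* d :* con 1ℚ := con 1ℚ :+ (con 2ℚ :* P :- con 1ℚ) :* d) refl d (2ℚ ^ k) ⟩
    1ℚ ℚ.+ (2ℚ ℚ.* 2ℚ ^ k ℚ.- 1ℚ) ℚ.* d ∎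
    where
    open +-*-Solver
    open ℚP.≤-Reasoning
    E : ℚ
    E = 2ℚ ^ k ℚ.- 1ℚ
    0≤Ed : 0ℚ ℚ.≤ E ℚ.* d
    0≤Ed = ℚP.≤-trans (ℚP.≤-reflexive (sym (ℚP.*-zeroˡ d)))
      (ℚP.*-monoʳ-≤-nonNeg d {{ℚ.nonNegative 0≤d}} (ℚP.≤-trans (ℚP.≤-reflexive (sym (ℚP.+-inverseʳ 1ℚ))) (ℚP.+-monoˡ-≤ (ℚ.- 1ℚ) (1≤2^ k))))

  exponents-≤ : ∀ {s t} a b k a′ b′ k′ → 0ℚ ℚ.< s → s ℚ.≤ t →
                2ℚ ^ a ℚ.≤ s ^ suc k ℚ.* 2ℚ ^ b → t ^ suc k′ ℚ.* 2ℚ ^ b′ ℚ.≤ 2ℚ ^ a′ →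
                (a ⊖ b) ℚ./ suc k ℚ.≤ (a′ ⊖ b′) ℚ./ suc k′
  exponents-≤ {s} {t} a b k a′ b′ k′ 0<s s≤t h h′ =
    /-mono-≤ (a ⊖ b) (a′ ⊖ b′) k k′ (cross a b a′ b′ K K′ (2^-cancel-≤ _ _ (begin
      2ℚ ^ (a ℕ.* K′ ℕ.+ b′ ℕ.* K)             ≡⟨ Exp.^-homo-* 2ℚ (a ℕ.* K′) (b′ ℕ.* K) ⟩
      2ℚ ^ (a ℕ.* K′) ℚ.* 2ℚ ^ (b′ ℕ.* K)      ≡⟨ cong (ℚ._* 2ℚ ^ (b′ ℕ.* K)) (Exp.^-assocʳ 2ℚ a K′) ⟨
      (2ℚ ^ a) ^ K′ ℚ.* 2ℚ ^ (b′ ℕ.* K)        ≤⟨ ℚP.*-monoʳ-≤-nonNeg _ {{ℚ.nonNegative (ℚP.<⇒≤ (0<2^ (b′ ℕ.* K)))}} (^-mono K′ (0<2^ a) h) ⟩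
      (s ^ K ℚ.* 2ℚ ^ b) ^ K′ ℚ.* 2ℚ ^ (b′ ℕ.* K) ≡⟨ cong₂ ℚ._*_ (Exp.^-distrib-* (s ^ K) (2ℚ ^ b) K′) (sym (Exp.^-assocʳ 2ℚ b′ K)) ⟩
      (s ^ K) ^ K′ ℚ.* (2ℚ ^ b) ^ K′ ℚ.* (2ℚ ^ b′) ^ K
        ≡⟨ solve 3 (λ x y z → x :* y :* z := x :* z :* y) refl ((s ^ K) ^ K′) ((2ℚ ^ b) ^ K′) ((2ℚ ^ b′) ^ K) ⟩
      (s ^ K) ^ K′ ℚ.* (2ℚ ^ b′) ^ K ℚ.* (2ℚ ^ b) ^ K′
        ≡⟨ cong (λ u → u ℚ.* (2ℚ ^ b′) ^ K ℚ.* (2ℚ ^ b) ^ K′)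
             (trans (Exp.^-assocʳ s K K′) (trans (cong (s ^_) (ℕP.*-comm K K′)) (sym (Exp.^-assocʳ s K′ K)))) ⟩
      (s ^ K′) ^ K ℚ.* (2ℚ ^ b′) ^ K ℚ.* (2ℚ ^ b) ^ K′
        ≡⟨ cong (ℚ._* (2ℚ ^ b) ^ K′) (Exp.^-distrib-* (s ^ K′) (2ℚ ^ b′) K) ⟨
      (s ^ K′ ℚ.* 2ℚ ^ b′) ^ K ℚ.* (2ℚ ^ b) ^ K′
        ≤⟨ ℚP.*-monoʳ-≤-nonNeg _ {{ℚ.nonNegative (ℚP.<⇒≤ (^-pos K′ (0<2^ b)))}}
             (^-mono K (pos* (^-pos K′ 0<s) (0<2^ b′))
               (ℚP.≤-trans (ℚP.*-monoʳ-≤-nonNeg _ {{ℚ.nonNegative (ℚP.<⇒≤ (0<2^ b′))}} (^-mono K′ 0<s s≤t)) h′)) ⟩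
      (2ℚ ^ a′) ^ K ℚ.* (2ℚ ^ b) ^ K′          ≡⟨ cong₂ ℚ._*_ (Exp.^-assocʳ 2ℚ a′ K) (Exp.^-assocʳ 2ℚ b K′) ⟩
      2ℚ ^ (a′ ℕ.* K) ℚ.* 2ℚ ^ (b ℕ.* K′)      ≡⟨ Exp.^-homo-* 2ℚ (a′ ℕ.* K) (b ℕ.* K′) ⟨
      2ℚ ^ (a′ ℕ.* K ℕ.+ b ℕ.* K′)             ∎)))
    where
    open ℚP.≤-Reasoning
    open ℕ-Solver
    K K′ : ℕ
    K = suc k
    K′ = suc k′
    cross : ∀ a b a′ b′ K K′ → a ℕ.* K′ ℕ.+ b′ ℕ.* K ℕ.≤ a′ ℕ.* K ℕ.+ b ℕ.* K′ →
            (a ⊖ b) ℤ.* + K′ ℤ.≤ (a′ ⊖ b′) ℤ.* + K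
    cross a b a′ b′ K K′ h = Z.begin
      (a ⊖ b) ℤ.* + K′                   Z.≡⟨ expand a b K′ ⟩
      + (a ℕ.* K′) ℤ.- + (b ℕ.* K′)      Z.≤⟨ shuffle (a ℕ.* K′) (b ℕ.* K′) (a′ ℕ.* K) (b′ ℕ.* K) h ⟩
      + (a′ ℕ.* K) ℤ.- + (b′ ℕ.* K)      Z.≡⟨ expand a′ b′ K ⟨
      (a′ ⊖ b′) ℤ.* + K                  Z.∎
      where
      module Z = ℤP.≤-Reasoning
      expand : ∀ a b K → (a ⊖ b) ℤ.* + K ≡ + (a ℕ.* K) ℤ.- + (b ℕ.* K)
      expand a b K = trans (cong (ℤ._* + K) (sym (ℤP.m-n≡m⊖n a b)))
        (trans (ℤP.*-distribʳ-+ (+ K) (+ a) (ℤ.- + b))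
          (cong₂ ℤ._+_ (sym (ℤP.pos-* a K)) (trans (sym (ℤP.neg-distribˡ-* (+ b) (+ K))) (cong ℤ.-_ (sym (ℤP.pos-* b K))))))
      shuffle : ∀ p q r s → p ℕ.+ s ℕ.≤ r ℕ.+ q → + p ℤ.- + q ℤ.≤ + r ℤ.- + s
      shuffle p q r s h = subst₂ ℤ._≤_ (sym (ℤP.m-n≡m⊖n p q)) (sym (ℤP.m-n≡m⊖n r s))
        (subst₂ ℤ._≤_ (ℤP.+-cancelˡ-⊖ s p q) (trans (cong (q ℕ.+ r ⊖_) (ℕP.+-comm s q)) (ℤP.+-cancelˡ-⊖ q r s))
          (ℤP.⊖-monoˡ-≤ (s ℕ.+ q) (subst₂ ℕ._≤_ (ℕP.+-comm p s) (ℕP.+-comm r q) h)))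

-- 2 ^ ((a - b) / (1 + k)) ≤ s is expressed as 2 ^ a ≤ s ^ (1 + k) * 2 ^ b.
log₂ : ℝ⁺ → ℝ
log₂ x = squeeze A B A≤B close
  where
  A B : ℚ → Set
  A r = ∃ λ a → ∃ λ b → ∃ λ k → ∃ λ s → r ≡ (a ⊖ b) ℚ./ suc k ×
        0ℚ ℚ.< s × lower (real x) s × 2ℚ ^ a ℚ.≤ s ^ suc k ℚ.* 2ℚ ^ b
  B r = ∃ λ a → ∃ λ b → ∃ λ k → ∃ λ s → r ≡ (a ⊖ b) ℚ./ suc k ×
        upper (real x) s × s ^ suc k ℚ.* 2ℚ ^ b ℚ.≤ 2ℚ ^ a
  A≤B : ∀ {p q} → A p → B q → p ℚ.≤ q
  A≤B (a , b , k , s , refl , 0<s , s<x , h) (a′ , b′ , k′ , t , refl , x<t , h′) =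
    exponents-≤ a b k a′ b′ k′ 0<s (ℚP.<⇒≤ (lower<upper (real x) s<x x<t)) h h′
  close : ∀ {ε} → 0ℚ ℚ.< ε → ∃₂ λ p q → A p × B q × q ℚ.< p ℚ.+ ε
  close {ε} 0<ε =
    let (k , 2/K<ε) = small 0<ε
        K = suc k
        (d , 0<d , d2^K≡1) = recip (0<2^ K)
        (l , 0<l , l<x) = lower⁺ x
        (p , q , l≤p , p<x , x<q , h) = approx≥ (real x) l<x (pos* 0<l 0<d)
        0<p = ℚP.<-≤-trans 0<l l≤p
        0<q = lower<upper (real x) (positive x) x<q
        d≤1 = ℚP.≤-trans (ℚP.≤-reflexive (sym (ℚP.*-identityʳ d)))
               (ℚP.≤-trans (ℚP.*-monoˡ-≤-nonNeg d {{ℚ.nonNegative (ℚP.<⇒≤ 0<d)}} (1≤2^ K)) (ℚP.≤-reflexive d2^K≡1))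
        q≤ = begin
          q                          ≤⟨ ℚP.<⇒≤ h ⟩
          p ℚ.+ l ℚ.* d              ≤⟨ ℚP.+-monoʳ-≤ p (ℚP.*-monoʳ-≤-nonNeg d {{ℚ.nonNegative (ℚP.<⇒≤ 0<d)}} l≤p) ⟩
          p ℚ.+ p ℚ.* d              ≡⟨ ℕ-Solver.solve 2 (λ p d → p ℕ-Solver.:+ p ℕ-Solver.:* d ℕ-Solver.:= p ℕ-Solver.:* (ℕ-Solver.con 1 ℕ-Solver.:+ d)) refl p d ⟩
          p ℚ.* (1ℚ ℚ.+ d)           ∎
        factor = begin
          (1ℚ ℚ.+ d) ^ K                    ≤⟨ bernoulli K (ℚP.<⇒≤ 0<d) d≤1 ⟩
          1ℚ ℚ.+ (2ℚ ^ K ℚ.- 1ℚ) ℚ.* d      ≡⟨ solve 2 (λ d P → con 1ℚ :+ (P :- con 1ℚ) :* d := con 1ℚ :+ d :* P :- d) refl d (2ℚ ^ K) ⟩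
          1ℚ ℚ.+ d ℚ.* 2ℚ ^ K ℚ.- d         ≡⟨ cong (λ t → 1ℚ ℚ.+ t ℚ.- d) d2^K≡1 ⟩
          2ℚ ℚ.- d                          ≤⟨ ℚP.+-monoʳ-≤ 2ℚ (ℚP.neg-antimono-≤ (ℚP.<⇒≤ 0<d)) ⟩
          2ℚ ℚ.+ 0ℚ                         ≡⟨ ℚP.+-identityʳ 2ℚ ⟩
          2ℚ                                ∎
        (a , b , lo , hi) = floorLog (^-pos K 0<p)
        up = begin
          q ^ K ℚ.* 2ℚ ^ b                           ≤⟨ ℚP.*-monoʳ-≤-nonNeg (2ℚ ^ b) {{ℚ.nonNegative (ℚP.<⇒≤ (0<2^ b))}} (^-mono K 0<q q≤) ⟩
          (p ℚ.* (1ℚ ℚ.+ d)) ^ K ℚ.* 2ℚ ^ b          ≡⟨ cong (ℚ._* 2ℚ ^ b) (Exp.^-distrib-* p (1ℚ ℚ.+ d) K) ⟩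
          p ^ K ℚ.* (1ℚ ℚ.+ d) ^ K ℚ.* 2ℚ ^ b        ≡⟨ ℕ-Solver.solve 3 (λ x y z → x ℕ-Solver.:* y ℕ-Solver.:* z ℕ-Solver.:= y ℕ-Solver.:* (x ℕ-Solver.:* z)) refl (p ^ K) ((1ℚ ℚ.+ d) ^ K) (2ℚ ^ b) ⟩
          (1ℚ ℚ.+ d) ^ K ℚ.* (p ^ K ℚ.* 2ℚ ^ b)      ≤⟨ *-mono-≤ (ℚP.<⇒≤ (^-pos K (pos+ (from-yes (0ℚ ℚP.<? 1ℚ)) 0<d))) (ℚP.<⇒≤ (0<2^ (suc a))) factor (ℚP.<⇒≤ hi) ⟩
          2ℚ ℚ.* 2ℚ ^ suc a                          ∎
    in (a ⊖ b) ℚ./ K , (2 ℕ.+ a ⊖ b) ℚ./ K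
     , (a , b , k , p , refl , 0<p , p<x , lo)
     , (2 ℕ.+ a , b , k , q , refl , x<q , up)
     , ℚP.≤-<-trans (ℚP.≤-reflexive (trans (cong (ℚ._/ K) (sym (trans (ℤP.+-comm (a ⊖ b) (+ 2)) (ℤP.distribʳ-⊖-+-pos 2 a b)))) (/-+ (a ⊖ b) (+ 2) k)))
         (ℚP.+-monoʳ-< ((a ⊖ b) ℚ./ K) 2/K<ε)
    where
    open +-*-Solver
    open ℚP.≤-Reasoning

-- log₂ n for n ≥ 2, where it is positive.
lg : (n : ℕ) .{{_ : ℕ.NonTrivial n}} → ℝ⁺
lg n@(suc (suc m)) = log₂ (fromℕ⁺ n) ,
  (½ , (1 , 0 , 1 , s , refl , from-yes (0ℚ ℚP.<? s) , (fromℕℚ n , refl , s<n) , from-yes (2ℚ ^ 1 ℚP.≤? s ^ 2 ℚ.* 2ℚ ^ 0)) , from-yes (0ℚ ℚP.<? ½))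
  where
  s : ℚ
  s = + 3 ℚ./ 2
  s<n : s ℚ.< fromℕℚ n
  s<n = ℚP.<-≤-trans (from-yes (s ℚP.<? 2ℚ)) (fromℕℚ-mono (ℕ.s≤s (ℕ.s≤s ℕ.z≤n)))

------------------------------------------------------------------------
-- Asymptotics

-- e(n) = o(n)
IsLittleO[n] : (ℕ → ℝ) → Set
IsLittleO[n] e = ∀ ε → 0ℚ ℚ.< ε → ∃ λ N → ∀ n → N ℕ.≤ n →
  (fromℚ (ℚ.- (ε ℚ.* fromℕℚ n)) ≤ e n) × (e n ≤ fromℚ (ε ℚ.* fromℕℚ n))

infix 4 _∈O_

-- t(n) = O(g(n)); the bound g only has to be defined for n ≥ 2.
_∈O_ : (ℕ → ℕ) → ((n : ℕ) .{{_ : ℕ.NonTrivial n}} → ℝ) → Set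
t ∈O g = ∃₂ λ C N → ∀ n .{{_ : ℕ.NonTrivial n}} → N ℕ.≤ n → fromℕ (t n) ≤ C · g n

------------------------------------------------------------------------
-- Rank and select

rank : ∀ {n} → Fin n → Subset n → ℕ
rank x S = ∣ S ∩ tabulate (λ y → does (y FinP.≤? x)) ∣

-- The elements of S in increasing order; select S i is the (1 + i)-th smallest.
select : ∀ {n} (S : Subset n) → Fin ∣ S ∣ → Fin n
select (inside  ∷ S) zero    = zero
select (inside  ∷ S) (suc i) = suc (select S i)
select (outside ∷ S) i       = suc (select S i)

------------------------------------------------------------------------
-- Word RAM with w-bit words and bit-addressed memory

bit : ℕ → ℕ → Bool
bit a i = ((a / 2 ℕ.^ i) {{ℕP.m^n≢0 2 i}} % 2) ℕ.≡ᵇ 1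

-- The number whose k binary digits are b 0, …, b (k - 1), least significant first.
fromBits : ℕ → (ℕ → Bool) → ℕ
fromBits zero    b = 0
fromBits (suc k) b = (if b 0 then 1 else 0) ℕ.+ 2 ℕ.* fromBits k (λ i → b (suc i))

truncate : ℕ → ℕ → ℕ
truncate w a = (a % 2 ℕ.^ w) {{ℕP.m^n≢0 2 w}}

data Op : Set where
  add sub mul div mod bitand bitor bitxor shl shr eq lt : Op

-- Arithmetic is modulo 2 ^ w, so sub wraps around; division by zero yields 0.
⟦_⟧ : Op → ℕ → ℕ → ℕ → ℕ
⟦ add ⟧ w a b         = truncate w (a ℕ.+ b)
⟦ sub ⟧ w a b         = truncate w (a ℕ.+ (2 ℕ.^ w ℕ.∸ b))
⟦ mul ⟧ w a b         = truncate w (a ℕ.* b)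
⟦ div ⟧ w a zero      = 0
⟦ div ⟧ w a b@(suc _) = a / b
⟦ mod ⟧ w a zero      = 0
⟦ mod ⟧ w a b@(suc _) = a % b
⟦ bitand ⟧ w a b      = fromBits w (λ i → bit a i ∧ bit b i)
⟦ bitor ⟧ w a b       = fromBits w (λ i → bit a i ∨ bit b i)
⟦ bitxor ⟧ w a b      = fromBits w (λ i → (bit a i) xor (bit b i))
⟦ shl ⟧ w a b         = truncate w (a ℕ.* 2 ℕ.^ b)
⟦ shr ⟧ w a b         = (a / 2 ℕ.^ b) {{ℕP.m^n≢0 2 b}}
⟦ eq ⟧ w a b          = if a ℕ.≡ᵇ b then 1 else 0
⟦ lt ⟧ w a b          = if a ℕ.<ᵇ b then 1 else 0

data Operand : Set where
  reg lit : ℕ → Operand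

data Instruction : Set where
  compute : (dst : ℕ) → Op → Operand → Operand → Instruction
  load    : (dst : ℕ) (address len : Operand) → Instruction
  store   : (address len source : Operand) → Instruction
  jumpIf0 : (condition : Operand) (target : ℕ) → Instruction

Program : Set
Program = List Instruction

record State : Set where
  constructor ⟨_,_,_⟩
  field
    pc        : ℕ
    registers : ℕ → ℕ
    memory    : ℕ → Bool

open State public

value : ℕ → (ℕ → ℕ) → Operand → ℕ
value w r (reg i) = r i
value w r (lit a) = truncate w a

_[_≔_] : (ℕ → ℕ) → ℕ → ℕ → (ℕ → ℕ)
(r [ i ≔ a ]) j = if i ℕ.≡ᵇ j then a else r j

-- A memory access touches at most w consecutive bits, starting at any address.
execute : ℕ → Instruction → State → State
execute w (compute d op x y) ⟨ pc , r , m ⟩ =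
  ⟨ suc pc , r [ d ≔ ⟦ op ⟧ w (value w r x) (value w r y) ] , m ⟩
execute w (load d x l) ⟨ pc , r , m ⟩ =
  ⟨ suc pc , r [ d ≔ fromBits (value w r l ℕ.⊓ w) (λ i → m (value w r x ℕ.+ i)) ] , m ⟩
execute w (store x l y) ⟨ pc , r , m ⟩ = ⟨ suc pc , r , m′ ⟩
  where
  a : ℕ
  a = value w r x
  m′ : ℕ → Bool
  m′ j = if (a ℕ.≤ᵇ j) ∧ (j ℕ.<ᵇ a ℕ.+ (value w r l ℕ.⊓ w))
         then bit (value w r y) (j ℕ.∸ a)
         else m j
execute w (jumpIf0 x target) ⟨ pc , r , m ⟩ =
  ⟨ (if value w r x ℕ.≡ᵇ 0 then target else suc pc) , r , m ⟩

-- A program halts by moving pc past its last instruction; a halted state no longer changes.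
step : ℕ → Program → State → State
step w P s = maybe′ (λ i → execute w i s) s (head (drop (pc s) P))

run : ℕ → Program → ℕ → State → State
run w P zero    s = s
run w P (suc t) s = run w P t (step w P s)

-- Started with its argument in register 0 and 0 in the other registers, P halts
-- within t steps with the result in register 0.
Computes : (w : ℕ) → Program → (memory : ℕ → Bool) (argument t result : ℕ) → Set
Computes w P m x t y = length P ℕ.≤ pc s × registers s 0 ≡ y
  where
  s : State
  s = run w P t ⟨ 0 , (λ _ → 0) [ 0 ≔ truncate w x ] , m ⟩

------------------------------------------------------------------------
-- Static data structures for rank and select

-- The constant wordFactor and the two programs serve all n: what they need to
-- know about n and S must be part of the representation.
record StaticDictionary : Set where
  field
    wordFactor    : ℕ
    represent     : ∀ {n} → Subset n → List Bool
    rankProgram   : Program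
    selectProgram : Program

  wordSize : ℕ → ℕ
  wordSize n = wordFactor ℕ.* suc ⌊log₂ n ⌋

  size : ∀ {n} → Subset n → ℕ
  size S = length (represent S)

  -- The representation occupies the addresses from 0 on; the remaining memory is arbitrary.
  Stores : ∀ {n} → (ℕ → Bool) → Subset n → Set
  Stores m S = ∀ i → m (toℕ i) ≡ List.lookup (represent S) i

  AnswersRankWithin : (ℕ → ℕ) → Set
  AnswersRankWithin t = ∀ n (S : Subset n) (x : Fin n) m → Stores m S →
    Computes (wordSize n) rankProgram m (toℕ x) (t n) (rank x S)

  AnswersSelectWithin : (ℕ → ℕ) → Set
  AnswersSelectWithin t = ∀ n (S : Subset n) (i : Fin ∣ S ∣) m → Stores m S →
    Computes (wordSize n) selectProgram m (suc (toℕ i)) (t n) (toℕ (select S i))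

{-# OPTIONS --safe #-}
module Submission where

-- For S with m elements let g r be its r-th element (g 0 = 0) and h y the
-- number of its elements below y. Then rank x = h (x + 1), select i = g i, and
-- g r < y ⇔ r ≤ h y, so a table of either function answers one query by a
-- single lookup and the other by a binary search with O(log n) lookups.
-- With L = ⌊log₂ n⌋ and k ≈ log₂ L, the table of g takes m (L + 1) bits. The
-- table of h takes about n (k + 8) bits: blocks of 2ᵏ arguments share a word,
-- and each entry adds a difference of k bits to it. The bound allows
-- m (L - 2k) bits. If m ≤ n / k², then g exceeds this by only O(n / k) = o(n);
-- otherwise m (L - 2k) ≥ n (L - 2k) / k² pays for h once n is large.

-- Three facts fix `k`. Since `L + 1 ≤ 2ᵏ`, a word of `8 (L + 1)` bits shared by `2ᵏ` arguments
-- costs at most 8 bits per argument, the 8 in `k + 8`. Since `h` grows by at most 1 per argument,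
-- differences within a block fit into `k` bits. Since `log₂ n ≤ L + 1 ≤ 2ᵏ`, the logarithm in the
-- bound is at least `L - 2k`. So `g` takes `2k + 1` bits per element too many, and the threshold
-- divides `n` by `k²` because dividing by `k` would leave a multiple of `n`. As `L + 1 ≥ 2ᵏ⁻¹`
-- outgrows every polynomial in `k`, `h` can afford the factor `k²`. The growth of `g` has no such
-- bound; it is stored in the same format, but as one block with full-width entries. Hence one
-- program text reads both tables, and a mode word says which query has to search. The program
-- serves all `n`, so the word size, the table dimensions and the first search step are read from a
-- header.

module Vcode where

  open import Data.Bool.Base using (Bool; if_then_else_)
  open import Data.Empty using (⊥-elim)
  open import Data.Fin.Base as Fin using (Fin; toℕ)
  open import Data.Fin.Properties as FinP using (toℕ<n)
  open import Data.Fin.Subset using (Subset; inside; outside; _∩_; ∣_∣)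
  open import Data.Fin.Subset.Properties using (∣p∣≤n)
  open import Data.List.Base as List using (List; []; _∷_; _++_; length; head; drop; applyUpTo; concatMap)
  open import Data.List.Properties using (length-++; length-applyUpTo; drop-all)
  open import Data.Maybe.Base using (maybe′)
  open import Data.Nat.Base
  open import Data.Nat.DivMod hiding (result)
  open import Data.Nat.Induction using (<-wellFounded; Acc; acc)
  open import Data.Nat.Logarithm using (⌊log₂_⌋; ⌊log₂⌋-mono-≤; ⌊log₂[2^n]⌋≡n; ⌊log₂⌊n/2⌋⌋≡⌊log₂n⌋∸1)
  open import Data.Nat.Properties
  open import Data.Nat.Solver using (module +-*-Solver)
  open +-*-Solver using (solve; _:=_; con; _:+_; _:*_; _:^_; Polynomial)
  open import Data.Product.Base using (∃; _×_; _,_; proj₁; proj₂)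
  open import Data.Sum.Base using (_⊎_; inj₁; inj₂)
  open import Data.Vec.Base using ([]; _∷_; tabulate)
  open import Relation.Binary.PropositionalEquality
  open import Relation.Nullary using (¬_)
  open import Relation.Nullary.Decidable using (Dec; yes; no; does; dec-true; dec-false)
  open import Defs
    using ( rank; select; StaticDictionary; fromBits; truncate; ⟦_⟧; add; sub; mul; shr; eq; lt
          ; Instruction; reg; lit; compute; load; jumpIf0; Program
          ; State; ⟨_,_,_⟩; pc; registers; value; _[_≔_]; execute; step; run; Computes )

  -- Logarithms

  n<2^[1+⌊log₂n⌋] : ∀ n → n < 2 ^ suc ⌊log₂ n ⌋
  n<2^[1+⌊log₂n⌋] n with n <? 2 ^ suc ⌊log₂ n ⌋
  ... | yes n<2^ = n<2^
  ... | no  n≮2^ with () ← <-irrefl refl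
    (≤-trans (≤-reflexive (sym (⌊log₂[2^n]⌋≡n (suc ⌊log₂ n ⌋)))) (⌊log₂⌋-mono-≤ (≮⇒≥ n≮2^)))

  2*⌊n/2⌋≤n : ∀ n → 2 * ⌊ n /2⌋ ≤ n
  2*⌊n/2⌋≤n n = begin
    ⌊ n /2⌋ + (⌊ n /2⌋ + 0)  ≡⟨ cong (⌊ n /2⌋ +_) (+-identityʳ ⌊ n /2⌋) ⟩
    ⌊ n /2⌋ + ⌊ n /2⌋        ≤⟨ +-monoʳ-≤ ⌊ n /2⌋ (⌊n/2⌋≤⌈n/2⌉ n) ⟩
    ⌊ n /2⌋ + ⌈ n /2⌉        ≡⟨ ⌊n/2⌋+⌈n/2⌉≡n n ⟩
    n                        ∎
    where open ≤-Reasoning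

  2^⌊log₂n⌋≤n : ∀ n .{{_ : NonZero n}} → 2 ^ ⌊log₂ n ⌋ ≤ n
  2^⌊log₂n⌋≤n n = go n (<-wellFounded n)
    where
    open ≤-Reasoning
    go : ∀ n .{{_ : NonZero n}} → Acc _<_ n → 2 ^ ⌊log₂ n ⌋ ≤ n
    go 1 _ = ≤-refl
    go n@(suc (suc m)) (acc rec) = begin
      2 ^ ⌊log₂ n ⌋              ≤⟨ ^-monoʳ-≤ 2 (m≤n+m∸n ⌊log₂ n ⌋ 1) ⟩
      2 ^ suc (⌊log₂ n ⌋ ∸ 1)    ≡⟨ cong (λ l → 2 ^ suc l) (⌊log₂⌊n/2⌋⌋≡⌊log₂n⌋∸1 n) ⟨
      2 * 2 ^ ⌊log₂ ⌊ n /2⌋ ⌋    ≤⟨ *-monoʳ-≤ 2 (go ⌊ n /2⌋ (rec (⌊n/2⌋<n (suc m)))) ⟩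
      2 * ⌊ n /2⌋                ≤⟨ 2*⌊n/2⌋≤n n ⟩
      n                          ∎

  -- Words in memory

  Word : (ℕ → Bool) → ℕ → ℕ → ℕ → Set
  Word m a v x = fromBits v (λ i → m (a + i)) ≡ x

  -- For `a = 0` this unfolds to `Stores`; a general `a` lets words be peeled off one by one.
  Holds : (ℕ → Bool) → ℕ → List Bool → Set
  Holds m a bs = ∀ i → m (a + toℕ i) ≡ List.lookup bs i

  bits : ℕ → ℕ → List Bool
  bits zero    x = []
  bits (suc v) x = (x % 2 ≡ᵇ 1) ∷ bits v (x / 2)

  encode : ℕ → List ℕ → List Bool
  encode v = concatMap (bits v)

  length-bits : ∀ v x → length (bits v x) ≡ v
  length-bits zero    x = refl
  length-bits (suc v) x = cong suc (length-bits v (x / 2))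

  length-encode : ∀ v xs → length (encode v xs) ≡ length xs * v
  length-encode v []       = refl
  length-encode v (x ∷ xs) = trans (length-++ (bits v x)) (cong₂ _+_ (length-bits v x) (length-encode v xs))

  fromBits-cong : ∀ v {b c : ℕ → Bool} → (∀ i → b i ≡ c i) → fromBits v b ≡ fromBits v c
  fromBits-cong zero    b≗c = refl
  fromBits-cong (suc v) b≗c = cong₂ (λ b s → (if b then 1 else 0) + 2 * s) (b≗c 0) (fromBits-cong v (λ i → b≗c (suc i)))

  module _ (m : ℕ → Bool) where

    Holds-tail : ∀ a b {bs} → Holds m a (b ∷ bs) → Holds m (suc a) bs
    Holds-tail a b h i = trans (cong m (sym (+-suc a (toℕ i)))) (h (Fin.suc i))

    Holds-++ˡ : ∀ a bs {cs} → Holds m a (bs ++ cs) → Holds m a bs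
    Holds-++ˡ a (b ∷ bs) h Fin.zero = h Fin.zero
    Holds-++ˡ a (b ∷ bs) {cs} h (Fin.suc i) =
      trans (cong m (+-suc a (toℕ i))) (Holds-++ˡ (suc a) bs (Holds-tail a b {bs ++ cs} h) i)

    Holds-++ʳ : ∀ a bs {cs} → Holds m a (bs ++ cs) → Holds m (a + length bs) cs
    Holds-++ʳ a []       {cs} h = subst (λ a → Holds m a cs) (sym (+-identityʳ a)) h
    Holds-++ʳ a (b ∷ bs) {cs} h =
      subst (λ a → Holds m a cs) (sym (+-suc a (length bs))) (Holds-++ʳ (suc a) bs (Holds-tail a b {bs ++ cs} h))

    bits⇒Word : ∀ a v {x} → x < 2 ^ v → Holds m a (bits v x) → Word m a v x
    bits⇒Word a zero {zero} _ _ = refl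
    bits⇒Word a zero {suc x} (s≤s ()) _
    bits⇒Word a (suc v) {x} x<2^ h = begin
      (if m (a + 0) then 1 else 0) + 2 * fromBits v (λ i → m (a + suc i))
        ≡⟨ cong₂ (λ b s → (if b then 1 else 0) + 2 * s) (h Fin.zero)
             (trans (fromBits-cong v (λ i → cong m (+-suc a i)))
               (bits⇒Word (suc a) v x/2<2^ (Holds-tail a (x % 2 ≡ᵇ 1) {bits v (x / 2)} h))) ⟩
      (if x % 2 ≡ᵇ 1 then 1 else 0) + 2 * (x / 2)
        ≡⟨ cong₂ _+_ (low-bit (x % 2) (m%n<n x 2)) (*-comm 2 (x / 2)) ⟩
      x % 2 + x / 2 * 2
        ≡⟨ m≡m%n+[m/n]*n x 2 ⟨
      x ∎
      where
      open ≡-Reasoning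
      x/2<2^ : x / 2 < 2 ^ v
      x/2<2^ = m<n*o⇒m/o<n (subst (x <_) (*-comm 2 (2 ^ v)) x<2^)
      low-bit : ∀ r → r < 2 → (if r ≡ᵇ 1 then 1 else 0) ≡ r
      low-bit 0 _ = refl
      low-bit 1 _ = refl
      low-bit (suc (suc r)) (s≤s (s≤s ()))

    encode-∷ : ∀ a v x xs → x < 2 ^ v → Holds m a (encode v (x ∷ xs)) →
               Word m a v x × Holds m (a + v) (encode v xs)
    encode-∷ a v x xs x<2^ h =
      bits⇒Word a v x<2^ (Holds-++ˡ a (bits v x) {encode v xs} h) ,
      subst (λ l → Holds m (a + l) (encode v xs)) (length-bits v x) (Holds-++ʳ a (bits v x) h)

    encode-lookup : ∀ a v f c → (∀ i → i < c → f i < 2 ^ v) → Holds m a (encode v (applyUpTo f c)) →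
                    ∀ i → i < c → Word m (a + i * v) v (f i)
    encode-lookup a v f (suc c) f<2^ h i i<c with encode-∷ a v (f 0) (applyUpTo (λ i → f (suc i)) c) (f<2^ 0 (s≤s z≤n)) h
    encode-lookup a v f (suc c) f<2^ h zero    _         | word , _ =
      subst (λ a → Word m a v (f 0)) (sym (+-identityʳ a)) word
    encode-lookup a v f (suc c) f<2^ h (suc i) (s≤s i<c) | _ , h′ =
      subst (λ a → Word m a v (f (suc i))) (+-assoc a v (i * v))
        (encode-lookup (a + v) v (λ i → f (suc i)) c (λ i i<c → f<2^ (suc i) (s≤s i<c)) h′ i i<c)

  -- Arithmetic and execution on a machine with w-bit words

  module _ (w : ℕ) where

    truncate-< : ∀ {a} → a < 2 ^ w → truncate w a ≡ a
    truncate-< a<2^w = m<n⇒m%n≡m {{m^n≢0 2 w}} a<2^w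

    add-< : ∀ {x y a b} → x ≡ a → y ≡ b → a + b < 2 ^ w → ⟦ add ⟧ w x y ≡ a + b
    add-< refl refl = truncate-<

    mul-< : ∀ {x y a b} → x ≡ a → y ≡ b → a * b < 2 ^ w → ⟦ mul ⟧ w x y ≡ a * b
    mul-< refl refl = truncate-<

    lt-yes : ∀ {x y} → x < y → ⟦ lt ⟧ w x y ≡ 1
    lt-yes {x} {y} x<y = cong (if_then 1 else 0) (dec-true (x <? y) x<y)

    lt-no : ∀ {x y} → ¬ x < y → ⟦ lt ⟧ w x y ≡ 0
    lt-no {x} {y} x≮y = cong (if_then 1 else 0) (dec-false (x <? y) x≮y)

    shr-≡ : ∀ {x y a b} → x ≡ a → y ≡ b → ⟦ shr ⟧ w x y ≡ (a / 2 ^ b) {{m^n≢0 2 b}}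
    shr-≡ refl refl = refl

    module _ (P : Program) where

      -- A record, so that unification never unfolds run.
      record Runs (t : ℕ) (σ τ : State) : Set where
        constructor runs
        field run≡ : run w P t σ ≡ τ

      open Runs public

      Runs-refl : ∀ {σ} → Runs 0 σ σ
      Runs-refl = runs refl

      Runs-trans : ∀ {s t σ τ υ} → Runs s σ τ → Runs t τ υ → Runs (s + t) σ υ
      Runs-trans {zero}          (runs refl) h = h
      Runs-trans {suc s} {σ = σ} (runs g)    h = runs (run≡ (Runs-trans {s} {σ = step w P σ} (runs g) h))

      -- `Computes` looks at the state after exactly `t` steps; idle steps of the halted machine
      -- fill a shorter run up to the common time bound.
      Runs-halted : ∀ t {σ} → length P ≤ pc σ → Runs t σ σ
      Runs-halted zero        h = Runs-refl
      Runs-halted (suc t) {σ} h = runs (trans (cong (run w P t) halted) (run≡ (Runs-halted t h)))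
        where
        halted : step w P σ ≡ σ
        halted rewrite drop-all (pc σ) P h = refl

      record Halts (m : ℕ → Bool) (x t y : ℕ) : Set where
        constructor halts
        field
          {final} : State
          runs-to : Runs t ⟨ 0 , (λ _ → 0) [ 0 ≔ truncate w x ] , m ⟩ final
          halted  : length P ≤ pc final
          answer  : registers final 0 ≡ y

      Halts⇒Computes : ∀ m x t y → Halts m x t y → Computes w P m x t y
      Halts⇒Computes m x t y (halts (runs refl) halted answer) = halted , answer

      module _ {m : ℕ → Bool} {k : ℕ} {is : List Instruction} {t : ℕ} {σ : State} where

        private
          stepping : ∀ {ρ i} → drop k P ≡ i ∷ is → Runs t (execute w i ⟨ k , ρ , m ⟩) σ → Runs (suc t) ⟨ k , ρ , m ⟩ σ
          stepping {ρ} e (runs h) =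
            runs (trans (cong (λ is → run w P t (maybe′ (λ i → execute w i ⟨ k , ρ , m ⟩) ⟨ k , ρ , m ⟩ (head is))) e) h)

        -- One rule per kind of instruction, for forward symbolic execution. The instruction is
        -- found through `drop k P`, which is `refl` for a concrete program and comes from
        -- `drop-suc` for `probe` at an unknown offset. The equation for `v` simplifies each result
        -- before it enters the registers.
        computing : ∀ {ρ d op x y v} → drop k P ≡ compute d op x y ∷ is →
                    ⟦ op ⟧ w (value w ρ x) (value w ρ y) ≡ v →
                    Runs t ⟨ suc k , ρ [ d ≔ v ] , m ⟩ σ → Runs (suc t) ⟨ k , ρ , m ⟩ σ
        computing e refl = stepping e

        loading : ∀ {ρ d x y l a v} → drop k P ≡ load d x y ∷ is →
                  value w ρ y ⊓ w ≡ l → value w ρ x ≡ a → Word m a l v →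
                  Runs t ⟨ suc k , ρ [ d ≔ v ] , m ⟩ σ → Runs (suc t) ⟨ k , ρ , m ⟩ σ
        loading e refl refl refl = stepping e

        jumping : ∀ {ρ x n} → drop k P ≡ jumpIf0 x n ∷ is → value w ρ x ≡ 0 →
                  Runs t ⟨ n , ρ , m ⟩ σ → Runs (suc t) ⟨ k , ρ , m ⟩ σ
        jumping {ρ} {n = n} e x≡0 h =
          stepping e (subst (λ x → Runs t ⟨ (if x ≡ᵇ 0 then n else suc k) , ρ , m ⟩ σ) (sym x≡0) h)

        passing : ∀ {ρ x n q} → drop k P ≡ jumpIf0 x n ∷ is → value w ρ x ≡ suc q →
                  Runs t ⟨ suc k , ρ , m ⟩ σ → Runs (suc t) ⟨ k , ρ , m ⟩ σ
        passing {ρ} {n = n} e x≡suc h =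
          stepping e (subst (λ x → Runs t ⟨ (if x ≡ᵇ 0 then n else suc k) , ρ , m ⟩ σ) (sym x≡suc) h)

  drop-suc : ∀ {A : Set} k (xs : List A) {y ys} → drop k xs ≡ y ∷ ys → drop (suc k) xs ≡ ys
  drop-suc zero    _        refl = refl
  drop-suc (suc k) (x ∷ xs) e    = drop-suc k xs e

  -- The query program

  probe : List Instruction
  probe =
      compute 11 shr (reg 13) (reg 5)
    ∷ compute 11 mul (reg 11) (reg 2)
    ∷ compute 11 add (reg 9) (reg 11)
    ∷ load    11 (reg 11) (reg 2)
    ∷ compute 12 mul (reg 13) (reg 6)
    ∷ compute 12 add (reg 7) (reg 12)
    ∷ load    12 (reg 12) (reg 6)
    ∷ compute 11 add (reg 11) (reg 12)
    ∷ []

  -- Registers: 0 argument and result, 2 word size, 3 whether to search,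
  -- 4 number of entries, 5 log₂ of the block size, 6 bits per entry,
  -- 7 address of the entries, 8 step of the search (a power of two),
  -- 9 address of the block values, 10 position of the search, 13 index to probe.
  -- The constant c is 1 for rank and 0 for select; it is both the shift of the
  -- argument and the mode of the code that needs a search.
  program : ℕ → Program
  program c =
      compute 0 add (reg 0) (lit c)
    ∷ compute 1 sub (lit 0) (lit 1)
    ∷ load    2 (lit 0) (reg 1)
    ∷ load    3 (reg 2) (reg 2)
    ∷ compute 3 eq (reg 3) (lit c)
    ∷ compute 9 add (reg 2) (reg 2)
    ∷ load    4 (reg 9) (reg 2)
    ∷ compute 9 add (reg 9) (reg 2)
    ∷ load    5 (reg 9) (reg 2)
    ∷ compute 9 add (reg 9) (reg 2)
    ∷ load    6 (reg 9) (reg 2)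
    ∷ compute 9 add (reg 9) (reg 2)
    ∷ load    7 (reg 9) (reg 2)
    ∷ compute 9 add (reg 9) (reg 2)
    ∷ load    8 (reg 9) (reg 2)
    ∷ compute 9 add (reg 9) (reg 2)
    ∷ jumpIf0 (reg 3) 36
    -- Head of the search loop, left once the step has been shifted down to 0.
    ∷ jumpIf0 (reg 8) 34
    ∷ compute 13 add (reg 10) (reg 8)
    ∷ probe ++
      -- No branching: the step is multiplied by two truth values, so it is added only if the probed
      -- index lies in the table and its value is below the argument.
      compute 12 lt (reg 13) (reg 4)
    ∷ compute 11 lt (reg 11) (reg 0)
    ∷ compute 12 mul (reg 12) (reg 11)
    ∷ compute 12 mul (reg 12) (reg 8)
    ∷ compute 10 add (reg 10) (reg 12)
    ∷ compute 8 shr (reg 8) (lit 1)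
    ∷ jumpIf0 (lit 0) 17
    ∷ compute 0 add (reg 10) (lit 0)
    ∷ jumpIf0 (lit 0) 46
    ∷ compute 13 add (reg 0) (lit 0)
    ∷ probe ++
      compute 0 add (reg 11) (lit 0)
    ∷ []

  block : ℕ → ℕ → ℕ
  block κ y = (y / 2 ^ κ) {{m^n≢0 2 κ}}

  floor : ℕ → ℕ → ℕ
  floor κ y = block κ y * 2 ^ κ

  floor≤ : ∀ κ y → floor κ y ≤ y
  floor≤ κ y = m/n*n≤m y (2 ^ κ) {{m^n≢0 2 κ}}

  -- The contract between encoder and program. `T+p<2^w` keeps a probed index, a position below `T`
  -- plus a step of at most `p`, from wrapping around; `8w<2^w` does the same for the header
  -- addresses and makes `w` itself representable.
  record Layout (w : ℕ) (m : ℕ → Bool) (mode T κ V R p : ℕ) (f : ℕ → ℕ) : Set where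
    field
      word₀     : Word m 0 w w
      word₁     : Word m w w mode
      word₂     : Word m (w + w) w T
      word₃     : Word m (w + w + w) w κ
      word₄     : Word m (w + w + w + w) w V
      word₅     : Word m (w + w + w + w + w) w R
      word₆     : Word m (w + w + w + w + w + w) w p
      directory : ∀ y → y < T → Word m (w + w + w + w + w + w + w + block κ y * w) w (f (floor κ y))
      entry     : ∀ y → y < T → Word m (R + y * V) V (f y ∸ f (floor κ y))
      directory-< : ∀ y → y < T → w + w + w + w + w + w + w + block κ y * w < 2 ^ w
      entry-<   : ∀ y → y < T → R + y * V < 2 ^ w
      f-<       : ∀ y → y < T → f y < 2 ^ w
      f-mono    : ∀ {x y} → x ≤ y → f x ≤ f y
      T+p<2^w   : T + p < 2 ^ w
      8w<2^w    : 8 * w < 2 ^ w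
      1≤w       : 1 ≤ w
      V≤w       : V ≤ w

  -- Correctness of the query program

  module _ {w : ℕ} {m : ℕ → Bool} {mode T κ V R p : ℕ} {f : ℕ → ℕ} (layout : Layout w m mode T κ V R p f) where
    open Layout layout

    private
      D : ℕ
      D = w + w + w + w + w + w + w

      8w≤ : ∀ j {k n} → n ≡ j * w → j + k ≡ 8 → n < 2 ^ w
      8w≤ j {k} refl e = ≤-<-trans (*-monoˡ-≤ w (subst (j ≤_) e (m≤m+n j k))) 8w<2^w

      1<2^w : 1 < 2 ^ w
      1<2^w = ≤-<-trans (≤-trans 1≤w (m≤m+n w (7 * w))) 8w<2^w

      0<2^w : 0 < 2 ^ w
      0<2^w = <-trans (s≤s z≤n) 1<2^w

      trunc0 : truncate w 0 ≡ 0
      trunc0 = truncate-< w 0<2^w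

      trunc1 : truncate w 1 ≡ 1
      trunc1 = truncate-< w 1<2^w

      <T⇒<2^w : ∀ {a} → a < T → a < 2 ^ w
      <T⇒<2^w a<T = <-trans a<T (≤-<-trans (m≤m+n T p) T+p<2^w)

      add-0 : ∀ {y b} → y ≡ b → b < 2 ^ w → ⟦ add ⟧ w y (truncate w 0) ≡ b
      add-0 {b = b} y≡b b<2^w = trans (add-< w y≡b trunc0 (subst (_< 2 ^ w) (sym (+-identityʳ b)) b<2^w)) (+-identityʳ b)

    record Loaded (a : ℕ) (ρ : ℕ → ℕ) : Set where
      constructor loaded
      field
        ρ0 : ρ 0 ≡ a
        ρ2 : ρ 2 ≡ w
        ρ4 : ρ 4 ≡ T
        ρ5 : ρ 5 ≡ κ
        ρ6 : ρ 6 ≡ V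
        ρ7 : ρ 7 ≡ R
        ρ9 : ρ 9 ≡ D

    -- For y ≥ T this is garbage read from arbitrary memory; guard discards it.
    probed : ℕ → ℕ
    probed y = truncate w
      ( fromBits w (λ i → m (truncate w (D + truncate w (block κ y * w)) + i))
      + fromBits V (λ i → m (truncate w (R + truncate w (y * V)) + i)))

    -- For `y < T` no address wraps around, and monotonicity makes the truncated difference exact,
    -- so adding the block value restores `f y`.
    probed≡f : ∀ {y} → y < T → probed y ≡ f y
    probed≡f {y} y<T = trans
      (add-< w
        (trans (cong (λ a → fromBits w (λ i → m (a + i)))
          (add-< w {x = D} refl (truncate-< w (≤-<-trans (m≤n+m _ D) (directory-< y y<T))) (directory-< y y<T))) (directory y y<T))
        (trans (cong (λ a → fromBits V (λ i → m (a + i)))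
          (add-< w {x = R} refl (truncate-< w (≤-<-trans (m≤n+m _ R) (entry-< y y<T))) (entry-< y y<T))) (entry y y<T))
        (subst (_< 2 ^ w) (sym sum) (f-< y y<T)))
      sum
      where
      sum : f (floor κ y) + (f y ∸ f (floor κ y)) ≡ f y
      sum = m+[n∸m]≡n (f-mono (floor≤ κ y))

    -- Stated for any index and any offset: the search also probes beyond the table, and `probe`
    -- occurs twice in the program.
    probing : ∀ P {k is a ρ y} → List.drop k P ≡ probe ++ is → Loaded a ρ → ρ 13 ≡ y →
      ∃ λ ρ′ → Runs w P 8 ⟨ k , ρ , m ⟩ ⟨ 8 + k , ρ′ , m ⟩ × Loaded a ρ′
             × ρ′ 8 ≡ ρ 8 × ρ′ 10 ≡ ρ 10 × ρ′ 11 ≡ probed y × ρ′ 13 ≡ y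
    probing P {k} {y = y} e0 (loaded ρ0 ρ2 ρ4 ρ5 ρ6 ρ7 ρ9) ρ13 =
      _ ,
      (computing w P {v = block κ y} e0 (shr-≡ w ρ13 ρ5)
      (computing w P {v = b} e1 (cong (⟦ mul ⟧ w (block κ y)) ρ2)
      (computing w P {v = truncate w (D + b)} e2 (cong (λ D → ⟦ add ⟧ w D b) ρ9)
      (loading   w P {l = w} {a = truncate w (D + b)} {v = d} e3 (trans (cong (_⊓ w) ρ2) (⊓-idem w)) refl refl
      (computing w P {v = o} e4 (cong₂ (⟦ mul ⟧ w) ρ13 ρ6)
      (computing w P {v = truncate w (R + o)} e5 (cong (λ R → ⟦ add ⟧ w R o) ρ7)
      (loading   w P {l = V} {a = truncate w (R + o)} {v = e} e6 (trans (cong (_⊓ w) ρ6) (m≤n⇒m⊓n≡m V≤w)) refl refl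
      (computing w P {v = probed y} e7 refl
      (Runs-refl w P))))))))) ,
      loaded ρ0 ρ2 ρ4 ρ5 ρ6 ρ7 ρ9 , refl , refl , refl , ρ13
      where
      b = truncate w (block κ y * w)
      o = truncate w (y * V)
      d = fromBits w (λ i → m (truncate w (D + b) + i))
      e = fromBits V (λ i → m (truncate w (R + o) + i))
      e1 = drop-suc k P e0
      e2 = drop-suc (1 + k) P e1
      e3 = drop-suc (2 + k) P e2
      e4 = drop-suc (3 + k) P e3
      e5 = drop-suc (4 + k) P e4
      e6 = drop-suc (5 + k) P e5
      e7 = drop-suc (6 + k) P e6

    setup : ∀ {a x c ρ} → c ≤ 1 → ρ 0 ≡ x → x + c ≡ a → a < 2 ^ w → ρ 10 ≡ 0 →
      ∃ λ ρ′ → Runs w (program c) 16 ⟨ 0 , ρ , m ⟩ ⟨ 16 , ρ′ , m ⟩ × Loaded a ρ′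
             × ρ′ 3 ≡ ⟦ eq ⟧ w mode c × ρ′ 8 ≡ p × ρ′ 10 ≡ 0
    setup {a} {x} {c} {ρ} c≤1 ρ0 x+c≡a a<2^w ρ10 =
      _ ,
      (computing w P refl (trans (add-< w ρ0 (truncate-< w (≤-<-trans c≤1 1<2^w)) (subst (_< 2 ^ w) (sym x+c≡a) a<2^w)) x+c≡a)
      (computing w P refl ones
      (loading   w P refl (m≥n⇒m⊓n≡n w≤ones) trunc0 word₀
      (loading   w P refl (⊓-idem w) refl word₁
      (computing w P refl (cong (⟦ eq ⟧ w mode) (truncate-< w (≤-<-trans c≤1 1<2^w)))
      (computing w P {v = w + w} refl (truncate-< w (8w≤ 2 l2 refl))
      (loading   w P refl (⊓-idem w) refl word₂
      (computing w P {v = w + w + w} refl (truncate-< w (8w≤ 3 l3 refl))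
      (loading   w P refl (⊓-idem w) refl word₃
      (computing w P {v = w + w + w + w} refl (truncate-< w (8w≤ 4 l4 refl))
      (loading   w P refl (⊓-idem w) refl word₄
      (computing w P {v = w + w + w + w + w} refl (truncate-< w (8w≤ 5 l5 refl))
      (loading   w P refl (⊓-idem w) refl word₅
      (computing w P {v = w + w + w + w + w + w} refl (truncate-< w (8w≤ 6 l6 refl))
      (loading   w P refl (⊓-idem w) refl word₆
      (computing w P {v = w + w + w + w + w + w + w} refl (truncate-< w (8w≤ 7 l7 refl))
      (Runs-refl w P))))))))))))))))) ,
      loaded refl refl refl refl refl refl refl , refl , refl , ρ10
      where
      P = program c
      -- The machine caps access lengths at w, so this length operand reads
      -- a full word before w is known.
      ones : ⟦ sub ⟧ w (truncate w 0) (truncate w 1) ≡ 2 ^ w ∸ 1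
      ones = trans (cong₂ (⟦ sub ⟧ w) trunc0 trunc1) (truncate-< w (∸-monoʳ-< (s≤s z≤n) (<⇒≤ 1<2^w)))
      w≤ones : w ≤ 2 ^ w ∸ 1
      w≤ones = ≤-pred (subst (suc w ≤_) (sym (m+[n∸m]≡n {1} (<⇒≤ 1<2^w))) (≤-<-trans (m≤m+n w (7 * w)) 8w<2^w))
      next : ∀ {k} j → k ≡ j * w → k + w ≡ suc j * w
      next j k≡ = trans (cong (_+ w) k≡) (+-comm (j * w) w)
      l2 : w + w ≡ 2 * w
      l2 = cong (w +_) (sym (+-identityʳ w))
      l3 = next 2 l2
      l4 = next 3 l3
      l5 = next 4 l4
      l6 = next 5 l5
      l7 = next 6 l6

    module _ {c a v : ℕ} (v<T : v < T) (below : (r : ℕ) → r < T → (f r < a → r ≤ v) × (r ≤ v → f r < a)) where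

      private
        P = program c

      -- The loop keeps `r ≤ v < r + 2 * q`, where `v` is the last index in the table with
      -- `f v < a`; the probe at `r + q` halves this interval.
      advance : ∀ {r q b} → r ≤ v → r + q < 2 ^ w → v < r + 2 * q → (b ≡ 1 × r + q ≤ v) ⊎ (b ≡ 0 × v < r + q) →
        let r′ = ⟦ add ⟧ w r (⟦ mul ⟧ w b q) in r′ ≤ v × v < r′ + q
      advance {r} {q} _ r+q<2^w v<r+2q (inj₁ (refl , r+q≤v)) =
        subst (λ r → r ≤ v × v < r + q) (sym (add-< w refl q≡ r+q<2^w)) (r+q≤v , subst (v <_) r+2q≡ v<r+2q)
        where
        q≡ : ⟦ mul ⟧ w 1 q ≡ q
        q≡ = trans (mul-< w {a = 1} {q} refl refl (subst (_< 2 ^ w) (sym (*-identityˡ q)) (≤-<-trans (m≤n+m q r) r+q<2^w))) (*-identityˡ q)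
        r+2q≡ : r + 2 * q ≡ r + q + q
        r+2q≡ = trans (cong (λ t → r + (q + t)) (+-identityʳ q)) (sym (+-assoc r q q))
      advance {r} {q} r≤v _ _ (inj₂ (refl , v<r+q)) =
        subst (λ r → r ≤ v × v < r + q) (sym (add-0 refl (<T⇒<2^w (≤-<-trans r≤v v<T)))) (r≤v , v<r+q)

      -- The product is the conjunction of the two comparisons. Because `v < T`, an index outside
      -- the table counts as too large, whatever was read there.
      guard : ∀ {y x} → (y < T → x ≡ f y) →
        let b = ⟦ mul ⟧ w (⟦ lt ⟧ w y T) (⟦ lt ⟧ w x a) in (b ≡ 1 × y ≤ v) ⊎ (b ≡ 0 × v < y)
      guard {y} x≡ with y <? T
      ... | no y≮T = inj₂ (mul-< w (lt-no w y≮T) refl 0<2^w , <-≤-trans v<T (≮⇒≥ y≮T))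
      ... | yes y<T with refl ← x≡ y<T | f y <? a
      ... | yes f<a = inj₁ (mul-< w (lt-yes w y<T) (lt-yes w f<a) 1<2^w , proj₁ (below y y<T) f<a)
      ... | no  f≮a = inj₂ (mul-< w (lt-yes w y<T) (lt-no w f≮a) 0<2^w , ≰⇒> (λ y≤v → f≮a (proj₂ (below y y<T) y≤v)))

      iteration : ∀ {ρ r q} → Loaded a ρ → ρ 8 ≡ q → ρ 10 ≡ r → 0 < q → q ≤ p → r ≤ v → v < r + 2 * q →
        ∃ λ ρ′ → Runs w P 17 ⟨ 17 , ρ , m ⟩ ⟨ 17 , ρ′ , m ⟩ × Loaded a ρ′
               × ρ′ 8 ≡ q / 2 × ρ′ 10 ≤ v × v < ρ′ 10 + q
      iteration {ρ} {r} {q@(suc _)} (loaded ρ0 ρ2 ρ4 ρ5 ρ6 ρ7 ρ9) ρ8 ρ10 0<q q≤p r≤v v<r+2q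
        with ld ← loaded {ρ = ρ [ 13 ≔ r + q ]} ρ0 ρ2 ρ4 ρ5 ρ6 ρ7 ρ9
        with ρ₁ , step , loaded σ0 σ2 σ4 σ5 σ6 σ7 σ9 , σ8 , σ10 , σ11 , σ13 ← probing P {k = 19} {ρ = ρ [ 13 ≔ r + q ]} refl ld refl =
        _ ,
        passing w P {k = 17} refl ρ8
        (computing w P refl (add-< w ρ10 ρ8 r+q<2^w)
        (Runs-trans w P step
        (computing w P {k = 27} {v = in-range} refl (cong₂ (⟦ lt ⟧ w) σ13 σ4)
        (computing w P {v = smaller} refl (cong₂ (⟦ lt ⟧ w) σ11 σ0)
        (computing w P {v = ⟦ mul ⟧ w in-range smaller} refl refl
        (computing w P {v = ⟦ mul ⟧ w (⟦ mul ⟧ w in-range smaller) q} refl (cong (⟦ mul ⟧ w (⟦ mul ⟧ w in-range smaller)) (trans σ8 ρ8))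
        (computing w P refl (cong (λ r → ⟦ add ⟧ w r (⟦ mul ⟧ w (⟦ mul ⟧ w in-range smaller) q)) (trans σ10 ρ10))
        (computing w P refl (shr-≡ w (trans σ8 ρ8) trunc1)
        (jumping w P refl trunc0
        (Runs-refl w P)))))))))) ,
        loaded σ0 σ2 σ4 σ5 σ6 σ7 σ9 , refl , advance r≤v r+q<2^w v<r+2q (guard probed≡f)
        where
        r+q<2^w : r + q < 2 ^ w
        r+q<2^w = ≤-<-trans (+-mono-≤ (≤-trans r≤v (<⇒≤ v<T)) q≤p) T+p<2^w
        in-range = ⟦ lt ⟧ w (r + q) T
        smaller  = ⟦ lt ⟧ w (probed (r + q)) a

      -- Induction on the exponent of the step. The last round has step 1 and leaves
      -- `r ≤ v < r + 1`; halving that step gives 0, which ends the loop.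
      descent : ∀ j {ρ} → Loaded a ρ → ρ 8 ≡ 2 ^ j → 2 ^ j ≤ p → ρ 10 ≤ v → v < ρ 10 + 2 * 2 ^ j →
        ∃ λ ρ′ → Runs w P (suc j * 17) ⟨ 17 , ρ , m ⟩ ⟨ 17 , ρ′ , m ⟩ × ρ′ 8 ≡ 0 × ρ′ 10 ≡ v
      descent j {ρ} ld ρ8 2^j≤p r≤v v<r+2^ with iteration ld ρ8 refl (m^n>0 2 j) 2^j≤p r≤v v<r+2^
      descent zero    ld ρ8 2^j≤p r≤v v<r+2^ | ρ′ , once , ld′ , ρ′8 , r′≤v , v<r′+1 =
        ρ′ , once , ρ′8 , ≤-antisym r′≤v (m<1+n⇒m≤n (subst (v <_) (+-comm (ρ′ 10) 1) v<r′+1))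
      descent (suc j) {ρ} ld ρ8 2^j≤p r≤v v<r+2^ | ρ′ , once , ld′ , ρ′8 , r′≤v , v<r′+q =
        let (ρ″ , more , facts) = descent j ld′ (trans ρ′8 (trans (cong (_/ 2) (*-comm 2 (2 ^ j))) (m*n/n≡m (2 ^ j) 2)))
                                    (≤-trans (m≤m+n (2 ^ j) _) 2^j≤p) r′≤v v<r′+q
        in ρ″ , Runs-trans w P once more , facts

    initial : ℕ → State
    initial x = ⟨ 0 , (λ _ → 0) [ 0 ≔ truncate w x ] , m ⟩

    search : ∀ {x c a v j} → c ≤ 1 → mode ≡ c → x + c ≡ a → a < 2 ^ w → p ≡ 2 ^ j → v < T → v < 2 * 2 ^ j →
             (∀ r → r < T → (f r < a → r ≤ v) × (r ≤ v → f r < a)) →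
             Halts w (program c) m x (27 + suc j * 17) v
    search {x} {c} {a} {v} {j} c≤1 mode≡c x+c≡a a<2^w p≡2^j v<T v<2^ below =
      let (ρ₁ , start , ld , σ3 , σ8 , σ10) = setup {c = c} {ρ = registers (initial x)} c≤1
            (truncate-< w (≤-<-trans (≤-trans (m≤m+n x c) (≤-reflexive x+c≡a)) a<2^w)) x+c≡a a<2^w refl
          (ρ₂ , loop , τ8 , τ10) = descent v<T below j ld (trans σ8 p≡2^j) (≤-reflexive (sym p≡2^j))
            (subst (_≤ v) (sym σ10) z≤n) (subst (λ r → v < r + 2 * 2 ^ j) (sym σ10) v<2^)
          stop : Runs w P 10 ⟨ 17 , ρ₂ , m ⟩ ⟨ 46 , ρ₂ [ 0 ≔ v ] , m ⟩
          stop = jumping w P {k = 17} refl τ8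
                (computing w P {k = 34} {v = v} refl (add-0 τ10 (<T⇒<2^w v<T))
                (jumping w P {k = 35} refl trunc0
                -- Three steps suffice; seven idle ones bring the part outside the loop to 27 = 16 +
                -- 1 + 1 + 8 + 1, the cost of the direct lookup in `fetch`.
                (Runs-halted w P 7 ≤-refl)))
          whole = Runs-trans w P start (passing w P {k = 16} refl (trans σ3 eq≡1) (Runs-trans w P loop stop))
      in halts (subst (λ t → Runs w P t (initial x) ⟨ 46 , ρ₂ [ 0 ≔ v ] , m ⟩) (cong (17 +_) (+-comm (suc j * 17) 10)) whole) ≤-refl refl
      where
      P = program c
      eq≡1 : ⟦ eq ⟧ w mode c ≡ 1
      eq≡1 = cong (if_then 1 else 0) (dec-true (mode ≟ c) mode≡c)

    fetch : ∀ {x c a} j → c ≤ 1 → mode ≢ c → x + c ≡ a → a < T →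
            Halts w (program c) m x (27 + suc j * 17) (f a)
    fetch {x} {c} {a} j c≤1 mode≢c x+c≡a a<T =
      let (ρ₁ , start , loaded σ0 σ2 σ4 σ5 σ6 σ7 σ9 , σ3 , _) = setup {c = c} {ρ = registers (initial x)} c≤1
            (truncate-< w (≤-<-trans (≤-trans (m≤m+n x c) (≤-reflexive x+c≡a)) (<T⇒<2^w a<T))) x+c≡a (<T⇒<2^w a<T) refl
          (ρ₂ , looked , _ , _ , _ , τ11 , _) = probing P {k = 37} {ρ = ρ₁ [ 13 ≔ a ]} {y = a} refl
            (loaded σ0 σ2 σ4 σ5 σ6 σ7 σ9) refl
      in halts (Runs-trans w P start
          (jumping w P {k = 16} refl (trans σ3 eq≡0)
          (computing w P {k = 36} {v = a} refl (add-0 σ0 (<T⇒<2^w a<T))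
          (Runs-trans w P looked
          (computing w P {k = 45} {v = f a} refl (add-0 (trans τ11 (probed≡f a<T)) (f-< a a<T))
          (Runs-halted w P (suc j * 17) ≤-refl)))))) ≤-refl refl
      where
      P = program c
      eq≡0 : ⟦ eq ⟧ w mode c ≡ 0
      eq≡0 = cong (if_then 1 else 0) (dec-false (mode ≟ c) mode≢c)

  -- Rank and select in terms of natural numbers

  below : ∀ {n} → Subset n → ℕ → ℕ
  below S             zero    = 0
  below []            (suc y) = 0
  below (inside ∷ S)  (suc y) = suc (below S y)
  below (outside ∷ S) (suc y) = below S y

  -- The value n for i ≥ ∣ S ∣ keeps element S monotone.
  element : ∀ {n} → Subset n → ℕ → ℕ
  element []            i       = 0
  element (inside ∷ S)  zero    = 0
  element (inside ∷ S)  (suc i) = suc (element S i)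
  element (outside ∷ S) i       = suc (element S i)

  -- With its converse `<below⇒element<`, this is the Galois connection that lets each table be
  -- searched for the other function. `y ≤ n` excludes the padding value `n`, which would pass for
  -- an element below `n + 1`.
  element<⇒<below : ∀ {n} (S : Subset n) i y → y ≤ n → element S i < y → i < below S y
  element<⇒<below (inside ∷ S)  zero    (suc y) _         _         = s≤s z≤n
  element<⇒<below (inside ∷ S)  (suc i) (suc y) (s≤s y≤n) (s≤s e<y) = s≤s (element<⇒<below S i y y≤n e<y)
  element<⇒<below (outside ∷ S) i       (suc y) (s≤s y≤n) (s≤s e<y) = element<⇒<below S i y y≤n e<y

  <below⇒element< : ∀ {n} (S : Subset n) i y → i < below S y → element S i < y
  <below⇒element< (inside ∷ S)  zero    (suc y) _         = s≤s z≤n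
  <below⇒element< (inside ∷ S)  (suc i) (suc y) (s≤s i<b) = s≤s (<below⇒element< S i y i<b)
  <below⇒element< (outside ∷ S) i       (suc y) i<b       = s≤s (<below⇒element< S i y i<b)

  below-mono : ∀ {n} (S : Subset n) {x y} → x ≤ y → below S x ≤ below S y
  below-mono S             z≤n       = z≤n
  below-mono []            (s≤s x≤y) = z≤n
  below-mono (inside ∷ S)  (s≤s x≤y) = s≤s (below-mono S x≤y)
  below-mono (outside ∷ S) (s≤s x≤y) = below-mono S x≤y

  below≤∣S∣ : ∀ {n} (S : Subset n) y → below S y ≤ ∣ S ∣
  below≤∣S∣ S             zero    = z≤n
  below≤∣S∣ []            (suc y) = z≤n
  below≤∣S∣ (inside ∷ S)  (suc y) = s≤s (below≤∣S∣ S y)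
  below≤∣S∣ (outside ∷ S) (suc y) = below≤∣S∣ S y

  -- Each step forward passes at most one element; this is why the entries of the dense table are
  -- short.
  below-+ : ∀ {n} (S : Subset n) x d → below S (d + x) ≤ d + below S x
  below-+ S             zero    zero    = z≤n
  below-+ []            x       zero    = ≤-refl
  below-+ []            x       (suc d) = z≤n
  below-+ (s ∷ S)       (suc x) zero    = ≤-refl
  below-+ (inside ∷ S)  zero    (suc d) = s≤s (below-+ S zero d)
  below-+ (outside ∷ S) zero    (suc d) = ≤-trans (below-+ S zero d) (n≤1+n _)
  below-+ (inside ∷ S)  (suc x) (suc d) = s≤s (subst (λ y → below S y ≤ d + suc (below S x)) (sym (+-suc d x))
    (≤-trans (below-+ S x (suc d)) (≤-reflexive (sym (+-suc d (below S x))))))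
  below-+ (outside ∷ S) (suc x) (suc d) = subst (λ y → below S y ≤ suc (d + below S x)) (sym (+-suc d x)) (below-+ S x (suc d))

  element≤n : ∀ {n} (S : Subset n) i → element S i ≤ n
  element≤n []            i       = z≤n
  element≤n (inside ∷ S)  zero    = z≤n
  element≤n (inside ∷ S)  (suc i) = s≤s (element≤n S i)
  element≤n (outside ∷ S) i       = s≤s (element≤n S i)

  element-mono : ∀ {n} (S : Subset n) {i j} → i ≤ j → element S i ≤ element S j
  element-mono []            i≤j       = z≤n
  element-mono (inside ∷ S)  z≤n       = z≤n
  element-mono (inside ∷ S)  (s≤s i≤j) = s≤s (element-mono S i≤j)
  element-mono (outside ∷ S) i≤j       = s≤s (element-mono S i≤j)

  toℕ-select : ∀ {n} (S : Subset n) i → toℕ (select S i) ≡ element S (toℕ i)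
  toℕ-select (inside ∷ S)  Fin.zero    = refl
  toℕ-select (inside ∷ S)  (Fin.suc i) = cong suc (toℕ-select S i)
  toℕ-select (outside ∷ S) i           = cong suc (toℕ-select S i)

  -- `b` is given only by its values, because the induction passes from `tabulate b` to the
  -- `tabulate` of a shifted function.
  ∣S∩[<y]∣≡below : ∀ {n} (S : Subset n) y (b : Fin n → Bool) → (∀ i → b i ≡ (toℕ i <ᵇ y)) →
                   ∣ S ∩ tabulate b ∣ ≡ below S y
  ∣S∩[<y]∣≡below []            zero    b b≡ = refl
  ∣S∩[<y]∣≡below []            (suc y) b b≡ = refl
  ∣S∩[<y]∣≡below (inside ∷ S)  zero    b b≡ rewrite b≡ Fin.zero = ∣S∩[<y]∣≡below S zero (λ i → b (Fin.suc i)) (λ i → b≡ (Fin.suc i))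
  ∣S∩[<y]∣≡below (inside ∷ S)  (suc y) b b≡ rewrite b≡ Fin.zero = cong suc (∣S∩[<y]∣≡below S y (λ i → b (Fin.suc i)) (λ i → b≡ (Fin.suc i)))
  ∣S∩[<y]∣≡below (outside ∷ S) zero    b b≡ = ∣S∩[<y]∣≡below S zero (λ i → b (Fin.suc i)) (λ i → b≡ (Fin.suc i))
  ∣S∩[<y]∣≡below (outside ∷ S) (suc y) b b≡ = ∣S∩[<y]∣≡below S y (λ i → b (Fin.suc i)) (λ i → b≡ (Fin.suc i))

  rank≡below : ∀ {n} (x : Fin n) S → rank x S ≡ below S (suc (toℕ x))
  rank≡below x S = ∣S∩[<y]∣≡below S (suc (toℕ x)) _ ≤?≡<ᵇ
    where
    ≤?≡<ᵇ : ∀ y → does (y FinP.≤? x) ≡ (toℕ y <ᵇ suc (toℕ x))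
    ≤?≡<ᵇ Fin.zero    = refl
    ≤?≡<ᵇ (Fin.suc y) = refl

  -- Codes of monotone functions

  module _ (w mode T κ V p : ℕ) (f : ℕ → ℕ) where

    blocks : ℕ
    blocks = suc (block κ (T ∸ 1))

    -- The header length is spelled as repeated addition, the form in which the program computes its
    -- addresses.
    base : ℕ
    base = w + w + w + w + w + w + w + blocks * w

    header : List ℕ
    header = w ∷ mode ∷ T ∷ κ ∷ V ∷ base ∷ p ∷ []

    directory entries : List ℕ
    directory = applyUpTo (λ b → f (b * 2 ^ κ)) blocks
    entries   = applyUpTo (λ y → f y ∸ f (floor κ y)) T

    code : List Bool
    code = encode w (header ++ directory) ++ encode V entries

    length-code : length code ≡ (7 + blocks) * w + T * V
    length-code = trans (length-++ (encode w (header ++ directory)))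
      (cong₂ _+_ (trans (length-encode w (header ++ directory)) (cong (λ l → (7 + l) * w) (length-applyUpTo (λ b → f (b * 2 ^ κ)) blocks)))
                 (trans (length-encode V entries) (cong (_* V) (length-applyUpTo _ T))))

    module _ (1≤T : 1 ≤ T) (mode≤1 : mode ≤ 1) (1≤w : 1 ≤ w) (V≤w : V ≤ w) (κ≤w : κ ≤ w) (T+p<2^w : T + p < 2 ^ w)
             (size<2^w : (7 + blocks) * w + T * V < 2 ^ w)
             (f<2^w : (y : ℕ) → y < T → f y < 2 ^ w) (f-mono : {x y : ℕ} → x ≤ y → f x ≤ f y)
             (entry<2^V : (y : ℕ) → y < T → f y ∸ f (floor κ y) < 2 ^ V) where

      private
        7w≡ : w + w + w + w + w + w + w ≡ 7 * w
        7w≡ = solve 1 (λ w → w :+ w :+ w :+ w :+ w :+ w :+ w := con 7 :* w) refl w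

        base≡ : base ≡ (7 + blocks) * w
        base≡ = trans (cong (_+ blocks * w) 7w≡) (sym (*-distribʳ-+ w 7 blocks))

        base+<2^w : base + T * V < 2 ^ w
        base+<2^w = subst (λ b → b + T * V < 2 ^ w) (sym base≡) size<2^w

        8w<2^w : 8 * w < 2 ^ w
        8w<2^w = ≤-<-trans (≤-trans (*-monoˡ-≤ w {8} {7 + blocks} (+-monoʳ-≤ 7 (s≤s z≤n))) (m≤m+n _ (T * V))) size<2^w

        w<2^w : w < 2 ^ w
        w<2^w = ≤-<-trans (m≤m+n w (7 * w)) 8w<2^w

        block<blocks : ∀ y → y < T → block κ y < blocks
        block<blocks y y<T = s≤s (/-monoˡ-≤ (2 ^ κ) {{m^n≢0 2 κ}} (≤-pred (subst (suc y ≤_) (sym (m+[n∸m]≡n 1≤T)) y<T)))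

        multiple<T : ∀ b → b < blocks → b * 2 ^ κ < T
        multiple<T b (s≤s b≤) = subst (suc (b * 2 ^ κ) ≤_) (m+[n∸m]≡n 1≤T) (s≤s (≤-trans (*-monoˡ-≤ (2 ^ κ) b≤) (floor≤ κ (T ∸ 1))))

      code⇒Layout : ∀ {m} → Holds m 0 code → Layout w m mode T κ V base p f
      code⇒Layout {m} h =
        let words = Holds-++ˡ m 0 (encode w (header ++ directory)) {encode V entries} h
            (word₀ , h₁) = encode-∷ m 0 w w (mode ∷ T ∷ κ ∷ V ∷ base ∷ p ∷ directory) w<2^w words
            (word₁ , h₂) = encode-∷ m _ w mode (T ∷ κ ∷ V ∷ base ∷ p ∷ directory) (≤-<-trans (≤-trans mode≤1 1≤w) w<2^w) h₁
            (word₂ , h₃) = encode-∷ m _ w T (κ ∷ V ∷ base ∷ p ∷ directory) (≤-<-trans (m≤m+n T p) T+p<2^w) h₂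
            (word₃ , h₄) = encode-∷ m _ w κ (V ∷ base ∷ p ∷ directory) (≤-<-trans κ≤w w<2^w) h₃
            (word₄ , h₅) = encode-∷ m _ w V (base ∷ p ∷ directory) (≤-<-trans V≤w w<2^w) h₄
            (word₅ , h₆) = encode-∷ m _ w base (p ∷ directory) (≤-<-trans (m≤m+n base (T * V)) base+<2^w) h₅
            (word₆ , h₇) = encode-∷ m _ w p (directory) (≤-<-trans (m≤n+m p T) T+p<2^w) h₆
            table : Holds m base (encode V entries)
            table = subst (λ a → Holds m a (encode V entries))
              (trans (length-encode w (header ++ directory))
                (trans (cong (λ l → (7 + l) * w) (length-applyUpTo (λ b → f (b * 2 ^ κ)) blocks)) (sym base≡)))
              (Holds-++ʳ m 0 (encode w (header ++ directory)) h)
        in record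
          { word₀       = word₀
          ; word₁       = word₁
          ; word₂       = word₂
          ; word₃       = word₃
          ; word₄       = word₄
          ; word₅       = word₅
          ; word₆       = word₆
          ; directory   = λ y y<T → encode-lookup m _ w (λ b → f (b * 2 ^ κ)) blocks (λ b b< → f<2^w _ (multiple<T b b<)) h₇
                                      (block κ y) (block<blocks y y<T)
          ; entry       = encode-lookup m base V (λ y → f y ∸ f (floor κ y)) T entry<2^V table
          ; directory-< = λ y y<T → ≤-<-trans (≤-trans (+-monoʳ-≤ (w + w + w + w + w + w + w) (*-monoˡ-≤ w (<⇒≤ (block<blocks y y<T)))) (m≤m+n base (T * V))) base+<2^w
          ; entry-<     = λ y y<T → ≤-<-trans (+-monoʳ-≤ base (*-monoˡ-≤ V (<⇒≤ y<T))) base+<2^w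
          ; f-<         = f<2^w
          ; f-mono      = f-mono
          ; T+p<2^w     = T+p<2^w
          ; 8w<2^w      = 8w<2^w
          ; 1≤w         = 1≤w
          ; V≤w         = V≤w
          }

  -- The dictionary

  n<2^n : ∀ n → n < 2 ^ n
  n<2^n zero    = s≤s z≤n
  n<2^n (suc n) = ≤-trans (+-mono-≤ (s≤s z≤n) (n<2^n n)) (≤-trans (≤-reflexive (+-comm 1 _)) (+-monoʳ-≤ (2 ^ n) (≤-trans (m^n>0 2 n) (≤-reflexive (sym (+-identityʳ _))))))

  wordBits : ℕ → ℕ
  wordBits n = suc ⌊log₂ n ⌋

  blockBits : ℕ → ℕ
  blockBits n = suc ⌊log₂ wordBits n ⌋

  threshold : ℕ → ℕ
  threshold n = n / (blockBits n * blockBits n)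

  n<2^wordBits : ∀ n → n < 2 ^ wordBits n
  n<2^wordBits = n<2^[1+⌊log₂n⌋]

  wordBits≤2^blockBits : ∀ n → wordBits n ≤ 2 ^ blockBits n
  wordBits≤2^blockBits n = <⇒≤ (n<2^[1+⌊log₂n⌋] (wordBits n))

  blockBits≤wordBits : ∀ n → blockBits n ≤ wordBits n
  blockBits≤wordBits n = ≤-trans (n<2^n ⌊log₂ wordBits n ⌋) (2^⌊log₂n⌋≤n (wordBits n))

  -- Here the word factor 8 pays off: of the eight factors `X ≥ 2`, six outweigh 37, which arises in
  -- `capacity` as 28 + 9.
  37X²<2^8W : ∀ W .{{_ : NonZero W}} → let X = 2 ^ W in 37 * (X * X) < 2 ^ (8 * W)
  37X²<2^8W W = begin-strict
    37 * (X * X)      <⟨ *-monoˡ-< (X * X) {{>-nonZero (*-mono-< {0} (m^n>0 2 W) (m^n>0 2 W))}} {37} {64} (m≤m+n 38 26) ⟩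
    2 ^ 6 * (X * X)   ≤⟨ *-monoˡ-≤ (X * X) (^-monoˡ-≤ 6 (^-monoʳ-≤ 2 (>-nonZero⁻¹ W))) ⟩
    X ^ 6 * (X * X)   ≡⟨ solve 1 (λ x → x :^ 6 :* (x :* x) := x :^ 8) refl X ⟩
    X ^ 8             ≡⟨ ^-*-assoc 2 W 8 ⟩
    2 ^ (W * 8)       ≡⟨ cong (2 ^_) (*-comm W 8) ⟩
    2 ^ (8 * W)       ∎
    where
    open ≤-Reasoning
    X : ℕ
    X = 2 ^ W

  2X≤X² : ∀ W .{{_ : NonZero W}} → let X = 2 ^ W in 2 * X ≤ X * X
  2X≤X² W = *-monoˡ-≤ (2 ^ W) (^-monoʳ-≤ 2 (>-nonZero⁻¹ W))

  -- Every address in the code must fit into a word; all dimensions are at most `2 ^ W`, so the size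
  -- is at most quadratic in it.
  capacity : ∀ {W b T V} .{{_ : NonZero W}} → b ≤ 2 ^ W → T ≤ 2 ^ W → V ≤ W →
             (7 + b) * (8 * W) + T * V < 2 ^ (8 * W)
  capacity {W} {b} {T} {V} b≤X T≤X V≤W = begin-strict
    (7 + b) * (8 * W) + T * V    ≤⟨ +-mono-≤ (*-mono-≤ (+-monoʳ-≤ 7 b≤X) (*-monoʳ-≤ 8 W≤X)) (*-mono-≤ T≤X (≤-trans V≤W W≤X)) ⟩
    (7 + X) * (8 * X) + X * X    ≡⟨ solve 1 (λ x → (con 7 :+ x) :* (con 8 :* x) :+ x :* x := con 28 :* (con 2 :* x) :+ con 9 :* (x :* x)) refl X ⟩
    28 * (2 * X) + 9 * (X * X)   ≤⟨ +-monoˡ-≤ (9 * (X * X)) (*-monoʳ-≤ 28 (2X≤X² W)) ⟩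
    28 * (X * X) + 9 * (X * X)   ≡⟨ *-distribʳ-+ (X * X) 28 9 ⟨
    37 * (X * X)                 <⟨ 37X²<2^8W W ⟩
    2 ^ (8 * W)                  ∎
    where
    open ≤-Reasoning
    X : ℕ
    X = 2 ^ W
    W≤X : W ≤ X
    W≤X = <⇒≤ (n<2^n W)

  -- The value 0 at index 0 is below every positive argument, so the search for a rank succeeds even
  -- if the rank is 0. The shift also matches the 1-based argument of select.
  nth : ∀ {n} → Subset n → ℕ → ℕ
  nth S zero    = 0
  nth S (suc i) = element S i

  nth≤n : ∀ {n} (S : Subset n) r → nth S r ≤ n
  nth≤n S zero    = z≤n
  nth≤n S (suc i) = element≤n S i

  nth-mono : ∀ {n} (S : Subset n) {r s} → r ≤ s → nth S r ≤ nth S s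
  nth-mono S z≤n       = z≤n
  nth-mono S (s≤s i≤j) = element-mono S i≤j

  -- With `κ = wordBits n`, `sparse` has a single block. The mode is the constant `c` of the query
  -- that needs a search: 1 for rank in `sparse`, 0 for select in `dense`. The first step is large
  -- enough because `n < 2 * 2 ^ ⌊log₂ n ⌋`.
  sparse dense : ∀ {n} → Subset n → List Bool
  sparse {n} S = code (8 * wordBits n) 1 (suc ∣ S ∣) (wordBits n) (wordBits n) (2 ^ ⌊log₂ n ⌋) (nth S)
  dense  {n} S = code (8 * wordBits n) 0 (suc n) (blockBits n) (blockBits n) (2 ^ ⌊log₂ n ⌋) (below S)

  representation : ∀ {n} (S : Subset n) → Dec (∣ S ∣ ≤ threshold n) → List Bool
  representation S (yes _) = sparse S
  representation S (no  _) = dense S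

  time : ℕ → ℕ
  time n = 27 + wordBits n * 17

  module _ {n : ℕ} (S : Subset n) where

    private
      L W w K X : ℕ
      L = ⌊log₂ n ⌋
      W = wordBits n
      w = 8 * W
      K = blockBits n
      X = 2 ^ W

      n<X : n < X
      n<X = n<2^wordBits n

      X≤2^w : X ≤ 2 ^ w
      X≤2^w = ^-monoʳ-≤ 2 (m≤m+n W (7 * W))

      blocks≤ : ∀ {T} κ → suc T ≤ X → suc (block κ T) ≤ X
      blocks≤ {T} κ T<X = ≤-trans (s≤s (m/n≤m T (2 ^ κ) {{m^n≢0 2 κ}})) T<X

      T+p<2^w : ∀ {T} → T ≤ X → T + 2 ^ L < 2 ^ w
      T+p<2^w {T} T≤X = ≤-<-trans (+-mono-≤ T≤X (^-monoʳ-≤ 2 (n≤1+n L)))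
        (≤-<-trans (≤-trans (≤-trans (≤-reflexive (cong (X +_) (sym (+-identityʳ X)))) (2X≤X² W)) (m≤m+n (X * X) (36 * (X * X)))) (37X²<2^8W W))

      ∣S∣<X : ∣ S ∣ < X
      ∣S∣<X = ≤-<-trans (∣p∣≤n S) n<X

    sparse-layout : ∀ {m} → Holds m 0 (sparse S) → Layout w m 1 (suc ∣ S ∣) W W _ (2 ^ L) (nth S)
    sparse-layout = code⇒Layout w 1 (suc ∣ S ∣) W W (2 ^ L) (nth S) (s≤s z≤n) ≤-refl (s≤s z≤n)
      (m≤m+n W (7 * W)) (m≤m+n W (7 * W)) (T+p<2^w ∣S∣<X) (capacity {W} (blocks≤ W ∣S∣<X) ∣S∣<X ≤-refl)
      (λ r _ → <-≤-trans (≤-<-trans (nth≤n S r) n<X) X≤2^w) (nth-mono S)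
      (λ r _ → ≤-<-trans (≤-trans (m∸n≤m (nth S r) (nth S (floor W r))) (nth≤n S r)) n<X)

    below-entry<2^ : ∀ κ y → below S y ∸ below S (floor κ y) < 2 ^ κ
    below-entry<2^ κ y = ≤-<-trans
      (≤-trans (∸-monoˡ-≤ (below S (floor κ y)) (subst (λ z → below S z ≤ y % 2^κ + below S (floor κ y)) (sym (m≡m%n+[m/n]*n y 2^κ)) (below-+ S (floor κ y) (y % 2^κ))))
        (≤-reflexive (m+n∸n≡m (y % 2^κ) (below S (floor κ y)))))
      (m%n<n y 2^κ)
      where
      2^κ : ℕ
      2^κ = 2 ^ κ
      instance
        2^κ≢0 : NonZero 2^κ
        2^κ≢0 = m^n≢0 2 κ

    dense-layout : ∀ {m} → Holds m 0 (dense S) → Layout w m 0 (suc n) K K _ (2 ^ L) (below S)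
    dense-layout = code⇒Layout w 0 (suc n) K K (2 ^ L) (below S) (s≤s z≤n) z≤n (s≤s z≤n)
      K≤w K≤w (T+p<2^w n<X) (capacity {W} (blocks≤ K n<X) n<X (blockBits≤wordBits n))
      (λ y _ → <-≤-trans (≤-<-trans (≤-trans (below≤∣S∣ S y) (∣p∣≤n S)) n<X) X≤2^w) (below-mono S)
      (λ y _ → below-entry<2^ K y)
      where
      K≤w : K ≤ w
      K≤w = ≤-trans (blockBits≤wordBits n) (m≤m+n W (7 * W))

    -- The decision `d` is an argument so that matching on it reduces `representation S d`.
    answers : ∀ d {m} → Holds m 0 (representation S d) →
              (∀ (x : Fin n) → Halts w (program 1) m (toℕ x) (time n) (rank x S)) ×
              (∀ (i : Fin ∣ S ∣) → Halts w (program 0) m (suc (toℕ i)) (time n) (toℕ (select S i)))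
    answers (yes _) {m} h = ranks , selects
      where
      ranks : ∀ (x : Fin n) → Halts w (program 1) m (toℕ x) (time n) (rank x S)
      ranks x = subst (Halts w (program 1) m (toℕ x) (time n)) (sym (rank≡below x S))
        (search (sparse-layout {m} h) {c = 1} {j = L} ≤-refl refl (+-comm (toℕ x) 1) (≤-<-trans (toℕ<n x) (<-≤-trans n<X X≤2^w)) refl
          (s≤s (below≤∣S∣ S (suc (toℕ x)))) (≤-<-trans (below≤∣S∣ S (suc (toℕ x))) ∣S∣<X)
          λ { zero    _ → (λ _ → z≤n) , (λ _ → s≤s z≤n)
            ; (suc i) _ → element<⇒<below S i (suc (toℕ x)) (toℕ<n x) , <below⇒element< S i (suc (toℕ x)) })
      selects : ∀ (i : Fin ∣ S ∣) → Halts w (program 0) m (suc (toℕ i)) (time n) (toℕ (select S i))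
      selects i = subst (Halts w (program 0) m (suc (toℕ i)) (time n)) (sym (toℕ-select S i))
        (fetch (sparse-layout {m} h) {c = 0} L z≤n (λ ()) (+-identityʳ (suc (toℕ i))) (s≤s (toℕ<n i)))
    answers (no _) {m} h = ranks , selects
      where
      ranks : ∀ (x : Fin n) → Halts w (program 1) m (toℕ x) (time n) (rank x S)
      ranks x = subst (Halts w (program 1) m (toℕ x) (time n)) (sym (rank≡below x S))
        (fetch (dense-layout {m} h) {c = 1} L ≤-refl (λ ()) (+-comm (toℕ x) 1) (s≤s (toℕ<n x)))
      selects : ∀ (i : Fin ∣ S ∣) → Halts w (program 0) m (suc (toℕ i)) (time n) (toℕ (select S i))
      selects i = subst (Halts w (program 0) m (suc (toℕ i)) (time n)) (sym (toℕ-select S i))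
        (search (dense-layout {m} h) {c = 0} {j = L} z≤n refl (+-identityʳ (suc (toℕ i)))
          (≤-<-trans (≤-trans (toℕ<n i) (∣p∣≤n S)) (<-≤-trans n<X X≤2^w)) refl
          (s≤s (element≤n S (toℕ i))) (≤-<-trans (element≤n S (toℕ i)) n<X)
          -- The Galois connection in negated form: `below S r ≤ toℕ i` fails exactly when
          -- `element S (toℕ i) < r`.
          λ r r≤n → (λ { (s≤s below≤i) → ≮⇒≥ (λ e<r → <⇒≱ (element<⇒<below S (toℕ i) r (≤-pred r≤n) e<r) below≤i) })
                  , (λ r≤e → s≤s (≮⇒≥ (λ i<below → <⇒≱ (<below⇒element< S (toℕ i) r i<below) r≤e))))

  vcode : StaticDictionary
  vcode = record
    { wordFactor    = 8
    ; represent     = λ {n} S → representation S (∣ S ∣ ≤? threshold n)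
    ; rankProgram   = program 1
    ; selectProgram = program 0
    }

  answersRank : StaticDictionary.AnswersRankWithin vcode time
  answersRank n S x m stored =
    Halts⇒Computes (StaticDictionary.wordSize vcode n) (StaticDictionary.rankProgram vcode) m (toℕ x) (time n) (rank x S) (proj₁ (answers S (∣ S ∣ ≤? threshold n) {m} stored) x)

  answersSelect : StaticDictionary.AnswersSelectWithin vcode time
  answersSelect n S i m stored =
    Halts⇒Computes (StaticDictionary.wordSize vcode n) (StaticDictionary.selectProgram vcode) m (suc (toℕ i)) (time n) (toℕ (select S i)) (proj₂ (answers S (∣ S ∣ ≤? threshold n) {m} stored) i)

  -- Size of the representation

  -- If `n ≤ m k²`, then the `n (k + 8)` bits of the dense table and the `2 k m` bits that the bound
  -- withholds come to at most this many bits per element.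
  denseCost : ℕ → ℕ
  denseCost k = k * k * (k + 8) + 2 * k

  -- Pays for the dense code of those finitely many n for which
  -- log₂ (n / lg² n) may be too small to do so.
  slack : ∀ n → Dec (denseCost (blockBits n) ≤ ⌊log₂ n ⌋) → ℕ
  slack n (yes _) = 0
  slack n (no  _) = n * (blockBits n + 8) + 2 * blockBits n * n

  enough? : ∀ n → Dec (denseCost (blockBits n) ≤ ⌊log₂ n ⌋)
  enough? n = denseCost (blockBits n) ≤? ⌊log₂ n ⌋

  -- An `o(n)` term may depend on `n` alone, so this covers the overheads of both tables at once.
  excess : ℕ → ℕ
  excess n = 65 * wordBits n + blockBits n + (1 + 2 * blockBits n) * threshold n + slack n (enough? n)

  module _ {n : ℕ} (S : Subset n) where

    private
      L W K : ℕ
      L = ⌊log₂ n ⌋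
      W = wordBits n
      K = blockBits n

    -- As `∣ S ∣ < 2 ^ W`, there is one block: seven header words and one directory word of `8 * W`
    -- bits give `64 * W`.
    length-sparse : length (sparse S) ≡ 64 * W + suc ∣ S ∣ * W
    length-sparse = trans (length-code (8 * W) 1 (suc ∣ S ∣) W W (2 ^ L) (nth S))
      (trans (cong (λ b → (8 + b) * (8 * W) + suc ∣ S ∣ * W) (m<n⇒m/n≡0 {{m^n≢0 2 W}} (≤-<-trans (∣p∣≤n S) (n<2^wordBits n))))
        (cong (_+ suc ∣ S ∣ * W) (sym (*-assoc 8 8 W))))

    -- Besides the first, there is one directory word per `2 ^ K` arguments, and `W ≤ 2 ^ K` turns
    -- its `8 * W` bits into 8 bits per argument.
    length-dense : length (dense S) ≤ 64 * W + K + n * (K + 8)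
    length-dense = begin
      length (dense S)
        ≡⟨ length-code (8 * W) 0 (suc n) K K (2 ^ L) (below S) ⟩
      (8 + block K n) * (8 * W) + suc n * K
        ≡⟨ solve 4 (λ b w n k → (con 8 :+ b) :* (con 8 :* w) :+ (con 1 :+ n) :* k := con 64 :* w :+ (k :+ n :* k) :+ con 8 :* (b :* w)) refl (block K n) W n K ⟩
      64 * W + (K + n * K) + 8 * (block K n * W)
        ≤⟨ +-monoʳ-≤ (64 * W + (K + n * K)) (*-monoʳ-≤ 8 (≤-trans (*-monoʳ-≤ (block K n) (wordBits≤2^blockBits n)) (floor≤ K n))) ⟩
      64 * W + (K + n * K) + 8 * n
        ≡⟨ solve 3 (λ w n k → con 64 :* w :+ (k :+ n :* k) :+ con 8 :* n := con 64 :* w :+ k :+ n :* (k :+ con 8)) refl W n K ⟩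
      64 * W + K + n * (K + 8) ∎
      where open ≤-Reasoning

    -- `2 * K * ∣ S ∣` is added to the size instead of subtracted from the bound, since `L` may be
    -- smaller than `2 * K`.
    size-sparse : ∣ S ∣ ≤ threshold n → length (sparse S) + 2 * K * ∣ S ∣ ≤ ∣ S ∣ * L + excess n
    size-sparse few = begin
      length (sparse S) + 2 * K * ∣ S ∣
        ≡⟨ cong (_+ 2 * K * ∣ S ∣) length-sparse ⟩
      64 * W + suc ∣ S ∣ * W + 2 * K * ∣ S ∣
        ≡⟨ solve 3 (λ l k m → con 64 :* (con 1 :+ l) :+ (con 1 :+ m) :* (con 1 :+ l) :+ con 2 :* k :* m
              := m :* l :+ (con 65 :* (con 1 :+ l) :+ (con 1 :+ con 2 :* k) :* m)) refl L K ∣ S ∣ ⟩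
      ∣ S ∣ * L + (65 * W + (1 + 2 * K) * ∣ S ∣)
        ≤⟨ +-monoʳ-≤ (∣ S ∣ * L) (+-mono-≤ (m≤m+n (65 * W) K) (*-monoʳ-≤ (1 + 2 * K) few)) ⟩
      ∣ S ∣ * L + (65 * W + K + (1 + 2 * K) * threshold n)
        ≤⟨ +-monoʳ-≤ (∣ S ∣ * L) (m≤m+n _ (slack n (enough? n))) ⟩
      ∣ S ∣ * L + excess n ∎
      where open ≤-Reasoning

    dense-pays : ¬ ∣ S ∣ ≤ threshold n → ∀ d → n * (K + 8) + 2 * K * ∣ S ∣ ≤ ∣ S ∣ * L + slack n d
    dense-pays many (yes cost≤L) = begin
      n * (K + 8) + 2 * K * ∣ S ∣
        ≤⟨ +-monoˡ-≤ (2 * K * ∣ S ∣) (*-monoˡ-≤ (K + 8) n≤mK²) ⟩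
      ∣ S ∣ * (K * K) * (K + 8) + 2 * K * ∣ S ∣
        ≡⟨ solve 2 (λ m k → m :* (k :* k) :* (k :+ con 8) :+ con 2 :* k :* m := m :* (k :* k :* (k :+ con 8) :+ con 2 :* k)) refl ∣ S ∣ K ⟩
      ∣ S ∣ * denseCost K
        ≤⟨ *-monoʳ-≤ ∣ S ∣ cost≤L ⟩
      ∣ S ∣ * L
        ≡⟨ +-identityʳ (∣ S ∣ * L) ⟨
      ∣ S ∣ * L + 0 ∎
      where
      open ≤-Reasoning
      n≤mK² : n ≤ ∣ S ∣ * (K * K)
      n≤mK² with ≤-total n (∣ S ∣ * (K * K))
      ... | inj₁ n≤ = n≤
      ... | inj₂ ≤n = ⊥-elim (many (≤-trans (≤-reflexive (sym (m*n/n≡m ∣ S ∣ (K * K)))) (/-monoˡ-≤ (K * K) ≤n)))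
    dense-pays many (no _) = ≤-trans (+-monoʳ-≤ (n * (K + 8)) (*-monoʳ-≤ (2 * K) (∣p∣≤n S))) (m≤n+m _ (∣ S ∣ * L))

    size-dense : ¬ ∣ S ∣ ≤ threshold n → length (dense S) + 2 * K * ∣ S ∣ ≤ ∣ S ∣ * L + excess n
    size-dense many = begin
      length (dense S) + 2 * K * ∣ S ∣
        ≤⟨ +-monoˡ-≤ (2 * K * ∣ S ∣) length-dense ⟩
      64 * W + K + n * (K + 8) + 2 * K * ∣ S ∣
        ≡⟨ +-assoc (64 * W + K) (n * (K + 8)) (2 * K * ∣ S ∣) ⟩
      64 * W + K + (n * (K + 8) + 2 * K * ∣ S ∣)
        ≤⟨ +-mono-≤ (≤-trans (+-monoˡ-≤ K (*-monoˡ-≤ W {64} {65} (n≤1+n 64))) (m≤m+n (65 * W + K) ((1 + 2 * K) * threshold n))) (dense-pays many (enough? n)) ⟩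
      65 * W + K + (1 + 2 * K) * threshold n + (∣ S ∣ * L + slack n (enough? n))
        ≡⟨ solve 3 (λ a b c → a :+ (b :+ c) := b :+ (a :+ c)) refl (65 * W + K + (1 + 2 * K) * threshold n) (∣ S ∣ * L) (slack n (enough? n)) ⟩
      ∣ S ∣ * L + excess n ∎
      where open ≤-Reasoning

    size-bound : ∀ d → length (representation S d) + 2 * K * ∣ S ∣ ≤ ∣ S ∣ * L + excess n
    size-bound (yes few)  = size-sparse few
    size-bound (no  many) = size-dense many

  -- Growth of the excess

  [1+n]²≤4*2^n : ∀ n → suc n * suc n ≤ 4 * 2 ^ n
  [1+n]²≤4*2^n 0 = m≤m+n 1 3
  [1+n]²≤4*2^n 1 = m≤m+n 4 4
  [1+n]²≤4*2^n 2 = m≤m+n 9 7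
  [1+n]²≤4*2^n (suc n@(suc (suc m))) = begin
    suc (suc n) * suc (suc n)                        ≤⟨ m≤m+n _ (m * m + 4 * m + 2) ⟩
    suc (suc n) * suc (suc n) + (m * m + 4 * m + 2)  ≡⟨ solve 1 (λ m → (con 4 :+ m) :* (con 4 :+ m) :+ (m :* m :+ con 4 :* m :+ con 2)
                                                          := con 2 :* ((con 3 :+ m) :* (con 3 :+ m))) refl m ⟩
    2 * (suc n * suc n)                              ≤⟨ *-monoʳ-≤ 2 ([1+n]²≤4*2^n n) ⟩
    2 * (4 * 2 ^ n)                                  ≡⟨ solve 1 (λ x → con 2 :* (con 4 :* x) := con 4 :* (con 2 :* x)) refl (2 ^ n) ⟩
    4 * 2 ^ suc n                                    ∎
    where open ≤-Reasoning

  -- Twice one value of the left side exceeds the next value by the polynomial `d`, whose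
  -- coefficients are all positive.
  denseCost<2^ : ∀ t → suc (denseCost (14 + t)) ≤ 2 ^ (13 + t)
  denseCost<2^ zero    = m≤m+n 4341 3851
  denseCost<2^ (suc t) = begin
    suc (denseCost (15 + t))         ≤⟨ m≤m+n _ d ⟩
    suc (denseCost (15 + t)) + d     ≡⟨ solve 1 (λ t → cost (con 15 :+ t) :+ (t :* t :* t :+ con 47 :* (t :* t) :+ con 711 :* t :+ con 3476)
                                          := con 2 :* cost (con 14 :+ t)) refl t ⟩
    2 * suc (denseCost (14 + t))     ≤⟨ *-monoʳ-≤ 2 (denseCost<2^ t) ⟩
    2 * 2 ^ (13 + t)                 ≡⟨ cong (2 ^_) (+-suc 13 t) ⟨
    2 ^ (13 + suc t)                 ∎
    where
    open ≤-Reasoning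
    d : ℕ
    d = t * t * t + 47 * (t * t) + 711 * t + 3476
    cost : ∀ {n} → Polynomial n → Polynomial n
    cost k = con 1 :+ (k :* k :* (k :+ con 8) :+ con 2 :* k)

  ⌊log₂⌋-≥ : ∀ {k n} → 2 ^ k ≤ n → k ≤ ⌊log₂ n ⌋
  ⌊log₂⌋-≥ {k} {n} 2^k≤n = subst (_≤ ⌊log₂ n ⌋) (⌊log₂[2^n]⌋≡n k) (⌊log₂⌋-mono-≤ 2^k≤n)

  -- Doubled, the claim splits into two parts of at most `n` each. `528 = 4 * 2 * 66` reduces the
  -- word-sized terms to `W * W ≤ 4 * n`. `2 ^ (13 + 6 * j)` forces `K ≥ 14 + 6 * j`: `6 * j ≤ K`
  -- bounds the threshold term, and 14 is where `denseCost<2^` starts, so the slack vanishes.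
  excess≤ : ∀ j n → 528 * j + 2 ^ (13 + 6 * j) ≤ ⌊log₂ n ⌋ → .{{_ : NonZero n}} → j * excess n ≤ n
  excess≤ j n large = *-cancelˡ-≤ 2 (begin
    2 * (j * excess n)
      ≡⟨ cong (λ s → 2 * (j * (65 * W + K + (1 + 2 * K) * threshold n + s))) (slack≡0 (enough? n)) ⟩
    2 * (j * (65 * W + K + (1 + 2 * K) * threshold n + 0))
      ≡⟨ solve 4 (λ j w k t → con 2 :* (j :* (con 65 :* w :+ k :+ (con 1 :+ con 2 :* k) :* t :+ con 0))
            := con 2 :* (j :* (con 65 :* w :+ k)) :+ con 2 :* (j :* (con 1 :+ con 2 :* k)) :* t) refl j W K (threshold n) ⟩
    2 * (j * (65 * W + K)) + 2 * (j * (1 + 2 * K)) * threshold n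
      ≤⟨ +-mono-≤ words gaps ⟩
    n + n
      ≡⟨ cong (n +_) (+-identityʳ n) ⟨
    2 * n ∎)
    where
    open ≤-Reasoning
    L W K : ℕ
    L = ⌊log₂ n ⌋
    W = wordBits n
    K = blockBits n
    K≥ : 13 + 6 * j ≤ ⌊log₂ W ⌋
    K≥ = ⌊log₂⌋-≥ (≤-trans (≤-trans (m≤n+m (2 ^ (13 + 6 * j)) (528 * j)) large) (n≤1+n L))
    13≤q : 13 ≤ ⌊log₂ W ⌋
    13≤q = ≤-trans (m≤m+n 13 (6 * j)) K≥
    cheap : denseCost K ≤ L
    cheap = ≤-pred (≤-trans
      (subst (λ q → suc (denseCost (suc q)) ≤ 2 ^ q) (m+[n∸m]≡n 13≤q) (denseCost<2^ (⌊log₂ W ⌋ ∸ 13)))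
      (2^⌊log₂n⌋≤n W))
    slack≡0 : ∀ d → slack n d ≡ 0
    slack≡0 (yes _)     = refl
    slack≡0 (no costly) = ⊥-elim (costly cheap)
    words : 2 * (j * (65 * W + K)) ≤ n
    words = *-cancelˡ-≤ 4 (begin
      4 * (2 * (j * (65 * W + K)))  ≤⟨ *-monoʳ-≤ 4 (*-monoʳ-≤ 2 (*-monoʳ-≤ j (+-monoʳ-≤ (65 * W) (blockBits≤wordBits n)))) ⟩
      4 * (2 * (j * (65 * W + W)))  ≡⟨ solve 2 (λ j w → con 4 :* (con 2 :* (j :* (con 65 :* w :+ w))) := con 528 :* j :* w) refl j W ⟩
      528 * j * W                   ≤⟨ *-monoˡ-≤ W (≤-trans (m≤m+n (528 * j) _) (≤-trans large (n≤1+n L))) ⟩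
      W * W                         ≤⟨ [1+n]²≤4*2^n L ⟩
      4 * 2 ^ L                     ≤⟨ *-monoʳ-≤ 4 (2^⌊log₂n⌋≤n n) ⟩
      4 * n                         ∎)
    gaps : 2 * (j * (1 + 2 * K)) * threshold n ≤ n
    gaps = begin
      2 * (j * (1 + 2 * K)) * threshold n   ≤⟨ *-monoˡ-≤ (threshold n) (*-monoʳ-≤ 2 (*-monoʳ-≤ j (+-monoˡ-≤ (2 * K) (s≤s (z≤n {⌊log₂ W ⌋}))))) ⟩
      2 * (j * (K + 2 * K)) * threshold n   ≡⟨ cong (_* threshold n) (solve 2 (λ j k → con 2 :* (j :* (k :+ con 2 :* k)) := con 6 :* j :* k) refl j K) ⟩
      6 * j * K * threshold n               ≤⟨ *-monoˡ-≤ (threshold n) (*-monoˡ-≤ K (≤-trans (m≤n+m (6 * j) 13) (≤-trans K≥ (n≤1+n _)))) ⟩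
      K * K * threshold n                   ≡⟨ *-comm (K * K) (threshold n) ⟩
      threshold n * (K * K)                 ≤⟨ m/n*n≤m n (K * K) ⟩
      n                                     ∎

  -- Abstract because unfolding the exponential bound makes type checking blow up.
  abstract

    excess-o[n] : ∀ j → ∃ λ N → ∀ n → N ≤ n → j * excess n ≤ n
    excess-o[n] j = 2 ^ k , λ n N≤n → excess≤ j n (⌊log₂⌋-≥ N≤n) {{>-nonZero (≤-trans (m^n>0 2 k) N≤n)}}
      where
      k : ℕ
      k = 528 * j + 2 ^ (13 + 6 * j)

  time≤ : ∀ n → 2 ≤ n → time n ≤ 61 * ⌊log₂ n ⌋
  time≤ n 2≤n = begin
    27 + (17 + L * 17)   ≤⟨ +-monoˡ-≤ (L * 17) {44} {44 * L} (m≤m*n 44 L {{>-nonZero (⌊log₂⌋-≥ 2≤n)}}) ⟩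
    44 * L + L * 17      ≡⟨ solve 1 (λ l → con 44 :* l :+ l :* con 17 := con 61 :* l) refl L ⟩
    61 * L               ∎
    where
    open ≤-Reasoning
    L : ℕ
    L = ⌊log₂ n ⌋

open Vcode

open import Data.Fin.Subset using (Subset; ∣_∣)
open import Data.Nat.Base using (ℕ; NonTrivial; nonTrivial⇒nonZero)
open import Data.Product.Base using (∃; _×_)
open import Defs using (ℝ; _≤_; _+_; _·_; _*_; _⁻¹; real; fromℕ; fromℕ⁺; log₂; lg; IsLittleO[n]; _∈O_; StaticDictionary)
open import Algebra.Bundles using (CommutativeRing)
open import Data.Empty using (⊥-elim)
open import Data.Integer.Base as ℤ using (+_; _⊖_)
import Data.Integer.Properties as ℤP
open import Data.Nat.Base as ℕ using (zero; suc)
open import Data.Nat.Logarithm using (⌊log₂_⌋)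
import Data.Nat.Properties as ℕP
open import Data.Product.Base using (_,_)
open import Data.Rational.Base as ℚ using (ℚ; 0ℚ; 1ℚ)
import Data.Rational.Properties as ℚP
open import Data.Sum.Base using (inj₁; inj₂)
open import Relation.Binary.PropositionalEquality using (_≡_; refl; sym; trans; cong; subst)
import Algebra.Solver.Ring.NaturalCoefficients.Default
  (CommutativeRing.commutativeSemiring ℚP.+-*-commutativeRing) as ℕ-Solver
import Algebra.Properties.CommutativeSemiring.Exp
  (CommutativeRing.commutativeSemiring ℚP.+-*-commutativeRing) as Exp
open Exp using (_^_)
open import Defs
  using ( ℝ⁺; lower; upper; located; fromℚ; fromℕℚ; fromℕℚ-suc; fromℕℚ-mono; n/1≡n; /-+; 2ℚ; 0<2^
        ; recip; recip-pos; pos*; *-mono-≤; small; 2/n*n; p≤p+q; exponents-≤ )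

-- Real bounds

fromℕℚ-+ : ∀ m n → fromℕℚ (m ℕ.+ n) ≡ fromℕℚ m ℚ.+ fromℕℚ n
fromℕℚ-+ zero    n = sym (ℚP.+-identityˡ (fromℕℚ n))
fromℕℚ-+ (suc m) n = trans (fromℕℚ-suc (m ℕ.+ n)) (trans (cong (1ℚ ℚ.+_) (fromℕℚ-+ m n))
  (trans (sym (ℚP.+-assoc 1ℚ (fromℕℚ m) (fromℕℚ n))) (cong (ℚ._+ fromℕℚ n) (sym (fromℕℚ-suc m)))))

fromℕℚ-* : ∀ m n → fromℕℚ (m ℕ.* n) ≡ fromℕℚ m ℚ.* fromℕℚ n
fromℕℚ-* zero    n = sym (ℚP.*-zeroˡ (fromℕℚ n))
fromℕℚ-* (suc m) n = trans (fromℕℚ-+ n (m ℕ.* n)) (trans (cong (fromℕℚ n ℚ.+_) (fromℕℚ-* m n))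
  (trans (solve 2 (λ m n → n :+ m :* n := (con 1 :+ m) :* n) refl (fromℕℚ m) (fromℕℚ n)) (cong (ℚ._* fromℕℚ n) (sym (fromℕℚ-suc m)))))
  where open ℕ-Solver

fromℕℚ-2^ : ∀ n → fromℕℚ (2 ℕ.^ n) ≡ 2ℚ ^ n
fromℕℚ-2^ zero    = refl
fromℕℚ-2^ (suc n) = trans (fromℕℚ-* 2 (2 ℕ.^ n)) (cong (2ℚ ℚ.*_) (fromℕℚ-2^ n))

0≤fromℕℚ : ∀ n → 0ℚ ℚ.≤ fromℕℚ n
0≤fromℕℚ n = fromℕℚ-mono (ℕ.z≤n {n})

m⊖n/1+n : ∀ m n → (m ⊖ n) ℚ./ 1 ℚ.+ fromℕℚ n ≡ fromℕℚ m
m⊖n/1+n m n = trans (cong ((m ⊖ n) ℚ./ 1 ℚ.+_) (sym (n/1≡n n)))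
  (trans (sym (/-+ (m ⊖ n) (+ n) 0)) (trans (cong (ℚ._/ 1) m⊖n+n) (n/1≡n m)))
  where
  m⊖n+n : (m ⊖ n) ℤ.+ + n ≡ + m
  m⊖n+n = trans (ℤP.+-comm (m ⊖ n) (+ n)) (trans (ℤP.distribʳ-⊖-+-pos n m n) (trans (cong (n ℕ.+ m ⊖_) (sym (ℕP.+-identityʳ n))) (ℤP.+-cancelˡ-⊖ n m 0)))

+-cancelʳ-≤ : ∀ {p q} r → p ℚ.+ r ℚ.≤ q ℚ.+ r → p ℚ.≤ q
+-cancelʳ-≤ r p+r≤q+r = ℚP.≮⇒≥ (λ q<p → ℚP.<-irrefl refl (ℚP.<-≤-trans (ℚP.+-monoˡ-< r q<p) p+r≤q+r))

infix 4 _⊑_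

-- r ⊑ x says r ≤ x by way of the upper cut of x, which unlike the lower cut
-- is easily combined through + and *.
_⊑_ : ℚ → ℝ → Set
r ⊑ x = ∀ {q} → upper x q → r ℚ.≤ q

-- For `p < q < r`, locatedness gives `p < x` or `x < q`, and the latter contradicts `r ≤ q`.
⊑⇒≤ : ∀ {r} x → r ⊑ x → fromℚ r ≤ x
⊑⇒≤ x r⊑x (_ , refl , p<r) with ℚP.<-dense p<r
... | q , p<q , q<r with located x p<q
... | inj₁ p<x = p<x
... | inj₂ x<q = ⊥-elim (ℚP.<-irrefl refl (ℚP.<-≤-trans q<r (r⊑x x<q)))

⊑-fromℚ : ∀ {r s} → r ℚ.≤ s → r ⊑ fromℚ s
⊑-fromℚ r≤s (_ , refl , s<q) = ℚP.≤-trans r≤s (ℚP.<⇒≤ s<q)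

⊑-+ : ∀ {r s} x y → r ⊑ x → s ⊑ y → r ℚ.+ s ⊑ x + y
⊑-+ x y r⊑x s⊑y (_ , (p , p′ , x<p , y<p′ , refl) , p+p′<q) = ℚP.≤-trans (ℚP.+-mono-≤ (r⊑x x<p) (s⊑y y<p′)) (ℚP.<⇒≤ p+p′<q)

⊑-· : ∀ {r} m x → r ⊑ x → fromℕℚ m ℚ.* r ⊑ m · x
⊑-· {r} zero    x r⊑x = ⊑-fromℚ (ℚP.≤-reflexive (ℚP.*-zeroˡ r))
⊑-· {r} (suc m) x r⊑x x<q = ℚP.≤-trans
  (ℚP.≤-reflexive (trans (cong (ℚ._* r) (fromℕℚ-suc m)) (solve 2 (λ m r → (con 1 :+ m) :* r := r :+ m :* r) refl (fromℕℚ m) r)))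
  (⊑-+ x (m · x) r⊑x (⊑-· m x r⊑x) x<q)
  where open ℕ-Solver

⊑-* : ∀ {r s} x y → 0ℚ ℚ.≤ r → 0ℚ ℚ.≤ s → r ⊑ real x → s ⊑ real y → r ℚ.* s ⊑ real (x * y)
⊑-* x y 0≤r 0≤s r⊑x s⊑y (_ , (p , p′ , x<p , y<p′ , refl) , pp′<q) =
  ℚP.≤-trans (*-mono-≤ 0≤r (ℚP.≤-trans 0≤s (s⊑y y<p′)) (r⊑x x<p) (s⊑y y<p′)) (ℚP.<⇒≤ pp′<q)

-- Inversion swaps the two cuts, so the upper bound `s` on `x` is phrased through the lower cut.
⊑-⁻¹ : ∀ {r s} x → 0ℚ ℚ.< r → 0ℚ ℚ.≤ s → (∀ {p} → lower (real x) p → p ℚ.≤ s) → r ℚ.* s ≡ 1ℚ → r ⊑ real (x ⁻¹)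
⊑-⁻¹ {r} {s} x 0<r 0≤s x≤s rs≡1 {q} (b , (p , 0<p , p<x , bp≡1) , b<q) = begin
  r                  ≡⟨ trans (cong (r ℚ.*_) bp≡1) (ℚP.*-identityʳ r) ⟨
  r ℚ.* (b ℚ.* p)    ≤⟨ ℚP.*-monoˡ-≤-nonNeg r {{ℚ.nonNegative (ℚP.<⇒≤ 0<r)}} (ℚP.*-monoˡ-≤-nonNeg b {{ℚ.nonNegative (ℚP.<⇒≤ (recip-pos b 0<p bp≡1))}} (x≤s p<x)) ⟩
  r ℚ.* (b ℚ.* s)    ≡⟨ solve 3 (λ r b s → r :* (b :* s) := b :* (r :* s)) refl r b s ⟩
  b ℚ.* (r ℚ.* s)    ≡⟨ trans (cong (b ℚ.*_) rs≡1) (ℚP.*-identityʳ b) ⟩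
  b                  ≤⟨ ℚP.<⇒≤ b<q ⟩
  q                  ∎
  where
  open ℚP.≤-Reasoning
  open ℕ-Solver

-- Monotonicity of the logarithm, from `exponents-≤` with an integral exponent on the left, that is,
-- denominator 1.
⊑-log₂ : ∀ {s} x a b → 0ℚ ℚ.< s → s ⊑ real x → 2ℚ ^ a ℚ.≤ s ℚ.* 2ℚ ^ b → (a ⊖ b) ℚ./ 1 ⊑ log₂ x
⊑-log₂ {s} x a b 0<s s⊑x 2^a≤ (_ , (a′ , b′ , k , t , refl , x<t , h) , p<q) = ℚP.≤-trans
  (exponents-≤ a b 0 a′ b′ k 0<s (s⊑x x<t) (subst (λ s → 2ℚ ^ a ℚ.≤ s ℚ.* 2ℚ ^ b) (sym (ℚP.*-identityʳ s)) 2^a≤) h)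
  (ℚP.<⇒≤ p<q)

log₂≤ : ∀ x a → (∀ {s} → lower (real x) s → s ℚ.≤ 2ℚ ^ a) → ∀ {p} → lower (log₂ x) p → p ℚ.≤ fromℕℚ a
log₂≤ x a x≤2^a (_ , (a′ , b′ , k , s , refl , 0<s , s<x , h) , p<r) = ℚP.≤-trans (ℚP.<⇒≤ p<r)
  (subst ((a′ ⊖ b′) ℚ./ suc k ℚ.≤_) (n/1≡n a)
    (exponents-≤ a′ b′ k a 0 0 0<s (x≤2^a s<x) h (ℚP.≤-reflexive (trans (ℚP.*-identityʳ _) (ℚP.*-identityʳ (2ℚ ^ a))))))

-- Bounds on lg n

2^⌊log₂n⌋⊑n : ∀ n .{{_ : ℕ.NonZero n}} → 2ℚ ^ ⌊log₂ n ⌋ ⊑ real (fromℕ⁺ n)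
2^⌊log₂n⌋⊑n n@(suc _) = ⊑-fromℚ (ℚP.≤-trans (ℚP.≤-reflexive (sym (fromℕℚ-2^ ⌊log₂ n ⌋))) (fromℕℚ-mono (2^⌊log₂n⌋≤n n)))

⌊log₂n⌋⊑lg : ∀ n .{{_ : NonTrivial n}} → fromℕℚ ⌊log₂ n ⌋ ⊑ real (lg n)
⌊log₂n⌋⊑lg n@(suc (suc _)) = subst (_⊑ real (lg n)) (n/1≡n ⌊log₂ n ⌋)
  (⊑-log₂ (fromℕ⁺ n) ⌊log₂ n ⌋ 0 (0<2^ ⌊log₂ n ⌋) (2^⌊log₂n⌋⊑n n) (ℚP.≤-reflexive (sym (ℚP.*-identityʳ _))))

lg≤wordBits : ∀ n .{{_ : NonTrivial n}} {p} → lower (real (lg n)) p → p ℚ.≤ fromℕℚ (wordBits n)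
lg≤wordBits n@(suc (suc _)) = log₂≤ (fromℕ⁺ n) (wordBits n) λ { (_ , refl , s<n) →
  ℚP.≤-trans (ℚP.<⇒≤ s<n) (ℚP.≤-trans (fromℕℚ-mono (ℕP.<⇒≤ (n<2^wordBits n))) (ℚP.≤-reflexive (fromℕℚ-2^ (wordBits n)))) }

-- The origin of `2 * blockBits n`: `lg n ≤ wordBits n ≤ 2 ^ blockBits n`, squared.
lg²≤ : ∀ n .{{_ : NonTrivial n}} {p} → lower (real (lg n * lg n)) p → p ℚ.≤ 2ℚ ^ (2 ℕ.* blockBits n)
lg²≤ n {p} (_ , (q , r , 0<q , q<lg , 0<r , r<lg , refl) , p<qr) = begin
  p                           ≤⟨ ℚP.<⇒≤ p<qr ⟩
  q ℚ.* r                     ≤⟨ *-mono-≤ (ℚP.<⇒≤ 0<q) (ℚP.<⇒≤ (0<2^ k)) (≤2^k q<lg) (≤2^k r<lg) ⟩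
  2ℚ ^ k ℚ.* 2ℚ ^ k           ≡⟨ Exp.^-homo-* 2ℚ k k ⟨
  2ℚ ^ (k ℕ.+ k)              ≡⟨ cong (λ l → 2ℚ ^ (k ℕ.+ l)) (ℕP.+-identityʳ k) ⟨
  2ℚ ^ (2 ℕ.* k)              ∎
  where
  open ℚP.≤-Reasoning
  k : ℕ
  k = blockBits n
  ≤2^k : ∀ {p} → lower (real (lg n)) p → p ℚ.≤ 2ℚ ^ k
  ≤2^k p<lg = ℚP.≤-trans (lg≤wordBits n p<lg) (ℚP.≤-trans (fromℕℚ-mono (wordBits≤2^blockBits n)) (ℚP.≤-reflexive (fromℕℚ-2^ k)))

⊑-log₂[n/lg²n] : ∀ n .{{_ : NonTrivial n}} →
  (⌊log₂ n ⌋ ⊖ 2 ℕ.* blockBits n) ℚ./ 1 ⊑ log₂ (fromℕ⁺ n {{nonTrivial⇒nonZero n}} * (lg n * lg n) ⁻¹)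
⊑-log₂[n/lg²n] n with recip (0<2^ (2 ℕ.* blockBits n))
-- `c` is the inverse of `2 ^ (2 * k)`, so `2 ^ L * c` is a rational lower bound on the argument of
-- the logarithm.
... | c , 0<c , c2^≡1 = ⊑-log₂ (N * (lg n * lg n) ⁻¹) L (2 ℕ.* k) (pos* (0<2^ L) 0<c)
  (⊑-* N ((lg n * lg n) ⁻¹) (ℚP.<⇒≤ (0<2^ L)) (ℚP.<⇒≤ 0<c) (2^⌊log₂n⌋⊑n n {{nonTrivial⇒nonZero n}})
    (⊑-⁻¹ (lg n * lg n) 0<c (ℚP.<⇒≤ (0<2^ (2 ℕ.* k))) (lg²≤ n) c2^≡1))
  (ℚP.≤-reflexive (sym (trans (ℚP.*-assoc (2ℚ ^ L) c _) (trans (cong (2ℚ ^ L ℚ.*_) c2^≡1) (ℚP.*-identityʳ (2ℚ ^ L))))))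
  where
  L k : ℕ
  L = ⌊log₂ n ⌋
  k = blockBits n
  N : ℝ⁺
  N = fromℕ⁺ n {{nonTrivial⇒nonZero n}}

-- Space and time bounds over the reals

size≤ : ∀ n .{{_ : NonTrivial n}} (S : Subset n) →
        fromℕ (StaticDictionary.size vcode S) ≤ ∣ S ∣ · log₂ (fromℕ⁺ n {{nonTrivial⇒nonZero n}} * (lg n * lg n) ⁻¹) + fromℕ (excess n)
size≤ n S = ⊑⇒≤ (m · x + fromℕ (excess n)) (λ x<q → ℚP.≤-trans bound
    (⊑-+ (m · x) (fromℕ (excess n)) (⊑-· m x (⊑-log₂[n/lg²n] n)) (⊑-fromℚ ℚP.≤-refl) x<q))
  where
  open ℕ-Solver
  open ℚP.≤-Reasoning
  m L c : ℕ
  m = ∣ S ∣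
  L = ⌊log₂ n ⌋
  c = 2 ℕ.* blockBits n
  x : ℝ
  x = log₂ (fromℕ⁺ n {{nonTrivial⇒nonZero n}} * (lg n * lg n) ⁻¹)
  d : ℚ
  d = (L ⊖ c) ℚ./ 1
  bound : fromℕℚ (StaticDictionary.size vcode S) ℚ.≤ fromℕℚ m ℚ.* d ℚ.+ fromℕℚ (excess n)
  bound = +-cancelʳ-≤ (fromℕℚ (c ℕ.* m)) (begin
    fromℕℚ (StaticDictionary.size vcode S) ℚ.+ fromℕℚ (c ℕ.* m)
      ≡⟨ fromℕℚ-+ (StaticDictionary.size vcode S) (c ℕ.* m) ⟨
    fromℕℚ (StaticDictionary.size vcode S ℕ.+ c ℕ.* m)
      ≤⟨ fromℕℚ-mono (size-bound S (m ℕP.≤? threshold n)) ⟩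
    fromℕℚ (m ℕ.* L ℕ.+ excess n)
      ≡⟨ trans (fromℕℚ-+ (m ℕ.* L) (excess n)) (cong (ℚ._+ fromℕℚ (excess n)) (trans (fromℕℚ-* m L) (cong (fromℕℚ m ℚ.*_) (sym (m⊖n/1+n L c))))) ⟩
    fromℕℚ m ℚ.* (d ℚ.+ fromℕℚ c) ℚ.+ fromℕℚ (excess n)
      ≡⟨ solve 4 (λ m d c e → m :* (d :+ c) :+ e := m :* d :+ e :+ c :* m) refl (fromℕℚ m) d (fromℕℚ c) (fromℕℚ (excess n)) ⟩
    fromℕℚ m ℚ.* d ℚ.+ fromℕℚ (excess n) ℚ.+ fromℕℚ c ℚ.* fromℕℚ m
      ≡⟨ cong (fromℕℚ m ℚ.* d ℚ.+ fromℕℚ (excess n) ℚ.+_) (fromℕℚ-* c m) ⟨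
    fromℕℚ m ℚ.* d ℚ.+ fromℕℚ (excess n) ℚ.+ fromℕℚ (c ℕ.* m) ∎)

excess≤εn : ∀ {ε k n} → 0ℚ ℚ.< ε → + 2 ℚ./ suc k ℚ.< ε → suc k ℕ.* excess n ℕ.≤ n → fromℕℚ (excess n) ℚ.≤ ε ℚ.* fromℕℚ n
excess≤εn {ε} {k} {n} 0<ε 2/K<ε small-excess = begin
  -- The doubling matches the numerator of `2 / suc k < ε`, the form in which `small` provides `k`.
  E                                  ≤⟨ p≤p+q E (0≤fromℕℚ (excess n)) ⟩
  E ℚ.+ E                            ≡⟨ solve 1 (λ e → e :+ e := con 2 :* e) refl E ⟩
  (1ℚ ℚ.+ 1ℚ) ℚ.* E                  ≡⟨ cong (ℚ._* E) (2/n*n k) ⟨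
  + 2 ℚ./ suc k ℚ.* K ℚ.* E          ≡⟨ ℚP.*-assoc (+ 2 ℚ./ suc k) K E ⟩
  + 2 ℚ./ suc k ℚ.* (K ℚ.* E)        ≤⟨ ℚP.*-monoʳ-≤-nonNeg (K ℚ.* E) {{ℚ.nonNegative 0≤KE}} (ℚP.<⇒≤ 2/K<ε) ⟩
  ε ℚ.* (K ℚ.* E)                    ≡⟨ cong (ε ℚ.*_) (fromℕℚ-* (suc k) (excess n)) ⟨
  ε ℚ.* fromℕℚ (suc k ℕ.* excess n)  ≤⟨ ℚP.*-monoˡ-≤-nonNeg ε {{ℚ.nonNegative (ℚP.<⇒≤ 0<ε)}} (fromℕℚ-mono small-excess) ⟩
  ε ℚ.* fromℕℚ n                     ∎
  where
  open ℕ-Solver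
  open ℚP.≤-Reasoning
  K E : ℚ
  K = fromℕℚ (suc k)
  E = fromℕℚ (excess n)
  0≤KE : 0ℚ ℚ.≤ K ℚ.* E
  0≤KE = subst (0ℚ ℚ.≤_) (fromℕℚ-* (suc k) (excess n)) (0≤fromℕℚ (suc k ℕ.* excess n))

excess-IsLittleO : IsLittleO[n] (λ n → fromℕ (excess n))
excess-IsLittleO ε 0<ε =
  let (k , 2/K<ε) = small 0<ε
      (N , small-excess) = excess-o[n] (suc k)
  in N , λ n N≤n →
    ⊑⇒≤ (fromℕ (excess n)) (⊑-fromℚ (ℚP.≤-trans (ℚP.neg-antimono-≤ (0≤εn n)) (0≤fromℕℚ (excess n)))) ,
    ⊑⇒≤ (fromℚ (ε ℚ.* fromℕℚ n)) (⊑-fromℚ (excess≤εn {k = k} {n} 0<ε 2/K<ε (small-excess n N≤n)))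
  where
  0≤εn : ∀ n → 0ℚ ℚ.≤ ε ℚ.* fromℕℚ n
  0≤εn n = ℚP.≤-trans (ℚP.≤-reflexive (sym (ℚP.*-zeroʳ ε))) (ℚP.*-monoˡ-≤-nonNeg ε {{ℚ.nonNegative (ℚP.<⇒≤ 0<ε)}} (0≤fromℕℚ n))

time⊑ : ∀ n .{{_ : NonTrivial n}} x → fromℕℚ ⌊log₂ n ⌋ ⊑ x → fromℕ (time n) ≤ 61 · x
time⊑ n x L⊑x = ⊑⇒≤ (61 · x) (λ x<q → ℚP.≤-trans
  (ℚP.≤-trans (fromℕℚ-mono (time≤ n (ℕ.nonTrivial⇒n>1 n))) (ℚP.≤-reflexive (fromℕℚ-* 61 ⌊log₂ n ⌋)))
  (⊑-· 61 x L⊑x x<q))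

time∈O[lg] : time ∈O λ n → real (lg n)
time∈O[lg] = 61 , 0 , λ n _ → time⊑ n (real (lg n)) (⌊log₂n⌋⊑lg n)

-- The same logarithmic `time` bounds both queries; `L ≤ L * L` for `L ≥ 1` turns it into the bound
-- for rank.
time∈O[lg²] : time ∈O λ n → real (lg n * lg n)
time∈O[lg²] = 61 , 0 , λ n _ → time⊑ n (real (lg n * lg n)) (λ lg²<q → ℚP.≤-trans
  (ℚP.≤-trans (fromℕℚ-mono (ℕP.m≤m*n ⌊log₂ n ⌋ ⌊log₂ n ⌋ {{ℕ.>-nonZero (⌊log₂⌋-≥ (ℕ.nonTrivial⇒n>1 n))}}))
    (ℚP.≤-reflexive (fromℕℚ-* ⌊log₂ n ⌋ ⌊log₂ n ⌋)))
  (⊑-* (lg n) (lg n) (0≤fromℕℚ _) (0≤fromℕℚ _) (⌊log₂n⌋⊑lg n) (⌊log₂n⌋⊑lg n) lg²<q))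

mainTheorem3 : ∃ λ (vcode : StaticDictionary) → let open StaticDictionary vcode in
    (∃ λ (e : ℕ → ℝ) → IsLittleO[n] e ×
    (∀ n .{{_ : NonTrivial n}} (S : Subset n) →
    fromℕ (size S) ≤ ∣ S ∣ · log₂ (fromℕ⁺ n {{nonTrivial⇒nonZero n}} * (lg n * lg n) ⁻¹) + e n))
    × (∃ λ (t : ℕ → ℕ) → (t ∈O λ n → real (lg n * lg n)) × AnswersRankWithin t)
    × (∃ λ (t : ℕ → ℕ) → (t ∈O λ n → real (lg n)) × AnswersSelectWithin t)
mainTheorem3 = vcode , ((λ n → fromℕ (excess n)) , excess-IsLittleO , size≤)
  , (time , time∈O[lg²] , answersRank) , (time , time∈O[lg] , answersSelect)
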